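{- There is an absolute constant $C>0$ such that for all positive integers $\ell,k$, every input of the online balanced graph repartitioning problem with $\ell$ clusters of capacity $k$, and every remapping event of COMP on that input, the remapping event affects at most $2^{Ck}$ clusters; that is, a remapping event of COMP affects at most $2^{O(k)}$ clusters.
   Context: Problem (online balanced graph repartitioning). There are $n=\ell\cdot k$ nodes and $\ell$ clusters. A mapping of nodes to clusters is valid if each cluster contains exactly $k$ nodes. The offline part of the input is the set of nodes together with an initial valid mapping. The online part is a finite sequence of requests, each being a pair of nodes $(u,v)$. After each request, an algorithm may change the current mapping to another valid mapping. Algorithm COMP. COMP works in phases. In each phase it maintains a partition $\mathcal R$ of the set of nodes into components; at the beginning of each phase every node is its own singleton component. It maintains the component invariant: for each component $S\in\mathcal R$, all nodes of $S$ are in the same cluster. When a request $(u,v)$ arrives: - If $u$ and $v$ are in the same component of $\mathcal R$, COMP does nothing. - If $u$ and $v$ are in different components $S_a$ and $S_b$, COMP replaces $S_a$ and $S_b$ in $\mathcal R$ by $S_{ab}=S_a\uplus S_b$. If $S_a$ and $S_b$ were in the same cluster, nothing else happens. If they were in different clusters, COMP checks whether there is a valid mapping of nodes to clusters satisfying the component invariant for the new $\mathcal R$. If so, a remapping event occurs: among all such mappings, COMP chooses one minimizing the number of affected clusters (clusters that some node leaves or enters, when passing from the current mapping to the new one), ties being broken arbitrarily, and changes to it. If no such valid mapping exists, COMP resets $\mathcal R$ to the partition into singletons and starts a new phase (keeping its current mapping). The number of clusters affected by a remapping event is the number of clusters whose set of nodes is changed by it. -}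

module Defs where

open import Data.Bool.Properties using () renaming (_≟_ to _≟ᵇ_)
open import Data.Fin using (Fin)
open import Data.Fin.Properties using (_≟_)
open import Data.Fin.Subset using (Subset; ∣_∣)
open import Data.List using (List; []; _∷_)
open import Data.Nat using (ℕ; _*_; _≤_)
open import Data.Product using (∃; _×_; _,_)
open import Data.Vec using (tabulate)
open import Data.Vec.Properties using (≡-dec)
open import Function using (id)
open import Relation.Binary.PropositionalEquality using (_≡_; _≢_)
open import Relation.Nullary using (¬_; does; yes; no)
open import Relation.Nullary.Decidable using (¬?)

-- ℓ clusters of capacity k.
module Repartitioning (ℓ k : ℕ) where

  Node : Set
  Node = Fin (ℓ * k)

  Cluster : Set
  Cluster = Fin ℓ

  Mapping : Set
  Mapping = Node → Cluster

  Request : Set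
  Request = Node × Node

  nodesIn : Mapping → Cluster → Subset (ℓ * k)
  nodesIn f c = tabulate (λ x → does (f x ≟ c))

  Valid : Mapping → Set
  Valid f = ∀ c → ∣ nodesIn f c ∣ ≡ k

  changed : Mapping → Mapping → Subset ℓ
  changed f g = tabulate (λ c → does (¬? (≡-dec _≟ᵇ_ (nodesIn f c) (nodesIn g c))))

  affected : Mapping → Mapping → ℕ
  affected f g = ∣ changed f g ∣

  -- A partition of the nodes is given by a labelling: its components are the
  -- nonempty fibres.  The choice of labels carries no meaning.
  Partition : Set
  Partition = Node → Node

  SameComponent : Partition → Node → Node → Set
  SameComponent R u v = R u ≡ R v

  singletons : Partition
  singletons = id

  merge : Partition → Node → Node → Partition
  merge R u v x with R x ≟ R v
  ... | yes _ = R u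
  ... | no  _ = R x

  Invariant : Partition → Mapping → Set
  Invariant R f = ∀ {x y} → SameComponent R x y → f x ≡ f y

  Feasible : Partition → Mapping → Set
  Feasible R f = Valid f × Invariant R f

  -- g is a feasible mapping for R that is cheapest to reach from f.
  Best : Partition → Mapping → Mapping → Set
  Best R f g = Feasible R g × (∀ h → Feasible R h → affected f g ≤ affected f h)

  record State : Set where
    constructor ⟨_,_⟩
    field
      components : Partition
      mapping    : Mapping

  -- One request served by COMP.  This is a relation rather than a function
  -- because ties in the choice of the new mapping are broken arbitrarily.
  data Step : State → Request → State → Set where
    skip  : ∀ {R f u v} → SameComponent R u v →
            Step ⟨ R , f ⟩ (u , v) ⟨ R , f ⟩
    join  : ∀ {R f u v} → ¬ SameComponent R u v → f u ≡ f v →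
            Step ⟨ R , f ⟩ (u , v) ⟨ merge R u v , f ⟩
    remap : ∀ {R f u v g} → ¬ SameComponent R u v → f u ≢ f v →
            Best (merge R u v) f g →
            Step ⟨ R , f ⟩ (u , v) ⟨ merge R u v , g ⟩
    reset : ∀ {R f u v} → ¬ SameComponent R u v → f u ≢ f v →
            ¬ ∃ (Feasible (merge R u v)) →
            Step ⟨ R , f ⟩ (u , v) ⟨ singletons , f ⟩

  data Run : State → List Request → State → Set where
    []  : ∀ {s} → Run s [] s
    _∷_ : ∀ {s t s′ r rs} → Step s r t → Run t rs s′ → Run s (r ∷ rs) s′

  initial : Mapping → State
  initial f₀ = ⟨ singletons , f₀ ⟩

  -- Some remapping event of the run changes the mapping from f to g.
  data RemapsIn (f g : Mapping) : ∀ {s rs s′} → Run s rs s′ → Set where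
    here  : ∀ {R u v s′ rs}
            {u≁v : ¬ SameComponent R u v} {fu≢fv : f u ≢ f v}
            {best : Best (merge R u v) f g}
            {run : Run ⟨ merge R u v , g ⟩ rs s′} →
            RemapsIn f g (remap {R} {f} {u} {v} {g} u≁v fu≢fv best ∷ run)
    there : ∀ {s t s′ r rs} {step : Step s r t} {run : Run t rs s′} →
            RemapsIn f g run → RemapsIn f g (step ∷ run)

{-# OPTIONS --safe #-}
module Submission where

-- Describe a cluster by its profile, the number of its components of each size;
-- the two components to be merged count as sizes of their own.  If h is any
-- feasible mapping after the merge, the profiles of the clusters of f and the
-- negated profiles of the clusters of h sum to zero.  A subfamily with zero sum
-- that contains the cluster of u yields a feasible mapping that affects no
-- cluster outside it: refill its f-clusters with the contents of its h-clusters.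
-- So one needs a zero-sum subfamily with only 2^O(k) members.
--
-- Since a profile x satisfies Σ i xᵢ ≤ O(k), integer vectors with Σ i |xᵢ| ≤ O(k²)
-- number only 2^O(k).  By the pigeonhole principle this bounds the entries of some
-- nonzero multiplicity vector (circuit) in the support of any balanced one.
-- Eliminating coordinates with circuits shows that a balanced vector with a large
-- entry dominates a circuit, which can be split off.

-- The bound must be single exponential, and entrywise estimates are too weak for that: vectors with
-- about k coordinates of size poly(k) number k^Θ(k). The weight i on coordinate i repairs this. Cut
-- coordinate i at a modulus of order n/i. The remainders then take n^n/n! · 2^O(n) = 2^O(n) values
-- together, and the quotients have sum O(n), so all of them fit into O(n) bits in unary. A circuit
-- is not yet a subfamily: its entries are small, but they may exceed the multiplicities at hand,
-- and it may miss the cluster of u. Hence circuits are split off only where they fit below the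
-- multiplicity vector, until one contains the class of u or no large entry is left. Constants, for
-- n = k + 2: a profile has weight at most 3n, a sum of 16n of them at most 48n². Such vectors have
-- codes of 6n + 7n = 13n bits (remainders, quotients), fewer than the 16n bits that name a subset
-- of 16n classes. About 2^(13n) classes with entries up to about 2^(26n) give 2^(41n).

import Algebra.Properties.Semiring.Sum as SemiringSum
open import Data.Bool using (Bool; true; false; if_then_else_)
import Data.Bool.Properties as Bool
open import Data.Fin
  using (Fin; zero; suc; toℕ; fromℕ<; inject≤; combine; finToFun; funToFin; punchIn; _↑ˡ_; _↑ʳ_; splitAt)
open import Data.Fin.Permutation using (Permutation′; _⟨$⟩ʳ_; _⟨$⟩ˡ_; insert; insert-punchIn; inverseʳ; inverseˡ)
import Data.Fin.Permutation as Perm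
open import Data.Fin.Properties
  using (_≟_; any?; ¬∀⟶∃¬; pigeonhole; toℕ<n; toℕ-injective; toℕ-fromℕ<; fromℕ<-injective; inject≤-injective;
         combine-injective; funToFin-finToFin; splitAt-↑ˡ; splitAt-↑ʳ)
import Data.Fin as Fin
import Data.Fin.Properties as Fin
open import Data.Fin.Subset using (∣_∣)
open import Data.Integer as ℤ using (ℤ; +_; -[1+_]; 0ℤ)
import Data.Integer.Properties as ℤ
open import Algebra.Properties.AbelianGroup ℤ.+-0-abelianGroup using (∙-cancelʳ; inverseˡ-unique)
open import Data.List using (List)
open import Data.Nat hiding (_≟_)
import Data.Nat.Properties as ℕ
open import Data.Nat.DivMod
open import Data.Nat.Properties hiding (_≟_)
open import Algebra.Properties.CommutativeSemigroup *-commutativeSemigroup using (x∙yz≈y∙xz; xy∙z≈y∙xz; x∙yz≈yx∙z)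
open import Data.Nat.Tactic.RingSolver using (solve-∀)
open import Data.Product using (∃; ∃₂; ∃-syntax; Σ-syntax; _×_; _,_; proj₁; proj₂)
open import Data.Sum using (_⊎_; inj₁; inj₂; [_,_])
open import Data.Vec using (tabulate)
open import Data.Vec.Properties using (tabulate-cong; ≡-dec)
open import Function using (_∘_; const)
open import Relation.Binary.PropositionalEquality hiding ([_])
open import Relation.Nullary using (¬_; yes; no; does; contradiction)
open import Relation.Nullary.Decidable using (¬?; dec-true; dec-false)
open import Defs

open SemiringSum +-*-semiring
  using (sum; sum-cong-≗; ∑-distrib-+; ∑-comm; *-distribˡ-sum; *-distribʳ-sum; sum-remove; sum-permute)
module ℤΣ = SemiringSum ℤ.+-*-semiring

-- Vectors of small weight

rising : ℕ → ℕ → ℕ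
rising N zero    = 1
rising N (suc m) = rising N m * (N + suc m)

-- Splits off the first factor of the product (N+1)···(N+m+1) instead of the last, as Pascal's rule
-- requires.
rising-shift : ∀ N m → rising N (suc m) ≡ rising (suc N) m * suc N
rising-shift N zero    = cong (_+ 0) (+-comm N 1)
rising-shift N (suc m) = begin
  rising N (suc m) * (N + suc (suc m))         ≡⟨ cong₂ _*_ (rising-shift N m) (+-suc N (suc m)) ⟩
  rising (suc N) m * suc N * (suc N + suc m)   ≡⟨ *-assoc (rising (suc N) m) _ _ ⟩
  rising (suc N) m * (suc N * (suc N + suc m)) ≡⟨ cong (rising (suc N) m *_) (*-comm (suc N) _) ⟩
  rising (suc N) m * ((suc N + suc m) * suc N) ≡⟨ *-assoc (rising (suc N) m) _ _ ⟨
  rising (suc N) (suc m) * suc N               ∎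
  where open ≡-Reasoning

-- Pascal's rule for the binomial coefficient rising N m / m !.
rising≤ : ∀ N m → rising N m ≤ 2 ^ (N + m) * m !
rising≤ N zero = *-mono-≤ (m^n>0 2 (N + 0)) (≤-refl {1})
rising≤ zero (suc m) = begin
  rising 0 m * suc m         ≤⟨ *-monoˡ-≤ (suc m) (rising≤ 0 m) ⟩
  2 ^ m * m ! * suc m        ≡⟨ (λ a b c → trans (*-assoc a b c) (cong (a *_) (*-comm b c))) (2 ^ m) (m !) (suc m) ⟩
  2 ^ m * suc m !            ≤⟨ *-monoˡ-≤ (suc m !) (^-monoʳ-≤ 2 (n≤1+n m)) ⟩
  2 ^ suc m * suc m !        ∎
  where open ≤-Reasoning
rising≤ (suc N) (suc m) = begin
  rising (suc N) m * (suc N + suc m)                           ≡⟨ *-distribˡ-+ (rising (suc N) m) (suc N) (suc m) ⟩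
  rising (suc N) m * suc N + rising (suc N) m * suc m
    ≡⟨ cong (_+ rising (suc N) m * suc m) (rising-shift N m) ⟨
  rising N (suc m) + rising (suc N) m * suc m
    ≤⟨ +-mono-≤ (rising≤ N (suc m)) (*-monoˡ-≤ (suc m) (rising≤ (suc N) m)) ⟩
  2 ^ (N + suc m) * suc m ! + 2 ^ (suc N + m) * m ! * suc m
    ≡⟨ cong (λ e → 2 ^ (N + suc m) * suc m ! + 2 ^ e * m ! * suc m) (+-suc N m) ⟨
  2 ^ (N + suc m) * suc m ! + 2 ^ (N + suc m) * m ! * suc m    ≡⟨ double (2 ^ (N + suc m)) (suc m) (m !) ⟩
  2 ^ (suc N + suc m) * suc m !                                ∎
  where
  open ≤-Reasoning
  double : ∀ a b c → a * (b * c) + a * c * b ≡ 2 * a * (b * c)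
  double = solve-∀

-- The factor `suc (N / suc i)` keeps the product of the moduli single exponential. The constant 16
-- makes the quotients of a vector of weight 48n² sum to at most 2 · 48n² / 16n = 6n.
base : ℕ → ℕ → ℕ
base N i = 16 * suc (N / suc i)

radix : ℕ → ℕ → ℕ
radix N zero    = 1
radix N (suc m) = radix N m * base N m

-- Each factor 1 + N/(i+1) is at most (N+i+1)/(i+1); the denominators multiply to m!, the numerators
-- to `rising N m`.
radix*!≤ : ∀ N m → radix N m * m ! ≤ 16 ^ m * rising N m
radix*!≤ N zero    = ≤-refl
radix*!≤ N (suc m) = begin
  radix N m * (16 * suc (N / suc m)) * (suc m * m !)    ≡⟨ regroup (radix N m) (suc (N / suc m)) (suc m) (m !) ⟩
  radix N m * m ! * (16 * (suc (N / suc m) * suc m))    ≤⟨ *-mono-≤ (radix*!≤ N m) (*-monoʳ-≤ 16 bound) ⟩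
  16 ^ m * rising N m * (16 * (N + suc m))              ≡⟨ regroup′ (16 ^ m) (rising N m) (N + suc m) ⟩
  16 * 16 ^ m * (rising N m * (N + suc m))              ∎
  where
  open ≤-Reasoning
  regroup : ∀ a b c d → a * (16 * b) * (c * d) ≡ a * d * (16 * (b * c))
  regroup = solve-∀
  regroup′ : ∀ a b c → a * b * (16 * c) ≡ 16 * a * (b * c)
  regroup′ = solve-∀
  bound : suc (N / suc m) * suc m ≤ N + suc m
  bound = begin
    suc m + N / suc m * suc m  ≤⟨ +-monoʳ-≤ (suc m) (m/n*n≤m N (suc m)) ⟩
    suc m + N                  ≡⟨ +-comm (suc m) N ⟩
    N + suc m                  ∎

radix≤ : ∀ n → radix n n ≤ 2 ^ (6 * n)
radix≤ n = *-cancelʳ-≤ _ _ (n !) {{n !≢0}} (begin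
  radix n n * n !                 ≤⟨ radix*!≤ n n ⟩
  16 ^ n * rising n n             ≤⟨ *-monoʳ-≤ (16 ^ n) (rising≤ n n) ⟩
  16 ^ n * (2 ^ (n + n) * n !)    ≡⟨ *-assoc (16 ^ n) _ _ ⟨
  16 ^ n * 2 ^ (n + n) * n !      ≡⟨ cong (λ x → x * 2 ^ (n + n) * n !) (^-*-assoc 2 4 n) ⟩
  2 ^ (4 * n) * 2 ^ (n + n) * n ! ≡⟨ cong (_* n !) (^-distribˡ-+-* 2 (4 * n) (n + n)) ⟨
  2 ^ (4 * n + (n + n)) * n !     ≡⟨ cong (λ e → 2 ^ e * n !) (six n) ⟩
  2 ^ (6 * n) * n !               ∎)
  where
  open ≤-Reasoning
  six : ∀ n → 4 * n + (n + n) ≡ 6 * n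
  six = solve-∀

-- Injective codes of 13n bits for integer vectors of weight at most 48n²

sumTo : ℕ → (ℕ → ℕ) → ℕ
sumTo zero    q = 0
sumTo (suc n) q = sumTo n q + q n

-- In binary, `m` ones and a terminating zero are attached at the low end of `x`: a prefix code that
-- costs m + 1 bits.
unary-∷ : ℕ → ℕ → ℕ
unary-∷ zero    x = 2 * x
unary-∷ (suc m) x = suc (2 * unary-∷ m x)

unary-∷-injective : ∀ m m′ {x x′} → unary-∷ m x ≡ unary-∷ m′ x′ → m ≡ m′ × x ≡ x′
unary-∷-injective zero    zero     eq = refl , *-cancelˡ-≡ _ _ 2 eq
unary-∷-injective zero    (suc m′) {x} {x′} eq = contradiction eq (even≢odd x (unary-∷ m′ x′))
unary-∷-injective (suc m) zero     {x} {x′} eq = contradiction (sym eq) (even≢odd x′ (unary-∷ m x))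
unary-∷-injective (suc m) (suc m′) eq
  with m≡m′ , x≡x′ ← unary-∷-injective m m′ (*-cancelˡ-≡ _ _ 2 (suc-injective eq))
  = cong suc m≡m′ , x≡x′

unary-∷-< : ∀ m {x a} → x < 2 ^ a → unary-∷ m x < 2 ^ (suc a + m)
unary-∷-< zero {x} {a} x<2^a = begin-strict
  2 * x             <⟨ *-monoʳ-< 2 x<2^a ⟩
  2 * 2 ^ a         ≡⟨ cong (2 ^_) (+-identityʳ (suc a)) ⟨
  2 ^ (suc a + 0)   ∎
  where open ≤-Reasoning
unary-∷-< (suc m) {x} {a} x<2^a = begin-strict
  suc (2 * unary-∷ m x)    <⟨ n<1+n _ ⟩
  2 + 2 * unary-∷ m x      ≡⟨ *-suc 2 (unary-∷ m x) ⟨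
  2 * suc (unary-∷ m x)    ≤⟨ *-monoʳ-≤ 2 (unary-∷-< m {a = a} x<2^a) ⟩
  2 ^ suc (suc a + m)      ≡⟨ cong (2 ^_) (+-suc (suc a) m) ⟨
  2 ^ (suc a + suc m)      ∎
  where open ≤-Reasoning

unary : ℕ → (ℕ → ℕ) → ℕ
unary zero    q = 0
unary (suc n) q = unary-∷ (q n) (unary n q)

unary-< : ∀ n q → unary n q < 2 ^ (n + sumTo n q)
unary-< zero    q = z<s
unary-< (suc n) q = subst (λ e → unary (suc n) q < 2 ^ suc e) (+-assoc n (sumTo n q) (q n))
                            (unary-∷-< (q n) {a = n + sumTo n q} (unary-< n q))

unary-injective : ∀ n {q q′} → unary n q ≡ unary n q′ → ∀ {i} → i < n → q i ≡ q′ i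
unary-injective (suc n) {q} {q′} eq {i} i<1+n
  with qₙ≡ , rest ← unary-∷-injective (q n) (q′ n) eq | m≤n⇒m<n∨m≡n (s≤s⁻¹ i<1+n)
... | inj₁ i<n  = unary-injective n rest i<n
... | inj₂ refl = qₙ≡

remainders : ∀ N n → (ℕ → ℕ) → Fin (radix N n)
remainders N zero    z = zero
remainders N (suc n) z = combine (remainders N n z) (z n mod base N n)

%≡toℕ-mod : ∀ m n .{{_ : NonZero n}} → toℕ (m mod n) ≡ m % n
%≡toℕ-mod m n = toℕ-fromℕ< (m%n<n m n)

remainders-injective : ∀ N n {z z′} → remainders N n z ≡ remainders N n z′ →
                       ∀ {i} → i < n → z i % base N i ≡ z′ i % base N i
remainders-injective N (suc n) {z} {z′} eq {i} i<1+n
  with rest , last ← combine-injective (remainders N n z) _ (remainders N n z′) _ eq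
     | m≤n⇒m<n∨m≡n (s≤s⁻¹ i<1+n)
... | inj₁ i<n  = remainders-injective N n rest i<n
... | inj₂ refl = trans (sym (%≡toℕ-mod (z n) (base N n))) (trans (cong toℕ last) (%≡toℕ-mod (z′ n) (base N n)))

zigzag : ℤ → ℕ
zigzag (+ m)    = 2 * m
zigzag -[1+ m ] = suc (2 * m)

zigzag-injective : ∀ x y → zigzag x ≡ zigzag y → x ≡ y
zigzag-injective (+ m)    (+ n)    eq = cong +_ (*-cancelˡ-≡ m n 2 eq)
zigzag-injective (+ m)    -[1+ n ] eq = contradiction eq (even≢odd m n)
zigzag-injective -[1+ m ] (+ n)    eq = contradiction (sym eq) (even≢odd n m)
zigzag-injective -[1+ m ] -[1+ n ] eq = cong -[1+_] (*-cancelˡ-≡ m n 2 (suc-injective eq))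

zigzag≤ : ∀ x → zigzag x ≤ 2 * ℤ.∣ x ∣
zigzag≤ (+ m)    = ≤-refl
zigzag≤ -[1+ m ] = ≤-trans (n≤1+n _) (≤-reflexive (sym (*-suc 2 m)))

-- Coordinate `i` counts components of kind `suc i`, hence the factor.
weight : ℕ → (ℕ → ℤ) → ℕ
weight n w = sumTo n (λ i → suc i * ℤ.∣ w i ∣)

module _ (n : ℕ) .{{_ : NonZero n}} where

  quotients : (ℕ → ℤ) → ℕ → ℕ
  quotients w i = zigzag (w i) / base n i

  -- The modulus times i + 1 exceeds 16n, so every unit of the quotient accounts for 16n units of
  -- twice the weight; the 2 comes from `zigzag`.
  quotient≤ : ∀ w i → quotients w i * (16 * n) ≤ 2 * (suc i * ℤ.∣ w i ∣)
  quotient≤ w i = begin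
    q * (16 * n)                       ≤⟨ *-monoʳ-≤ q (*-monoʳ-≤ 16 (<⇒≤ (m<n+m/n*n))) ⟩
    q * (16 * (suc (n / suc i) * suc i))   ≡⟨ regroup q (suc (n / suc i)) (suc i) ⟩
    q * base n i * suc i               ≤⟨ *-monoˡ-≤ (suc i) (m/n*n≤m (zigzag (w i)) (base n i)) ⟩
    zigzag (w i) * suc i               ≤⟨ *-monoˡ-≤ (suc i) (zigzag≤ (w i)) ⟩
    2 * ℤ.∣ w i ∣ * suc i              ≡⟨ regroup′ ℤ.∣ w i ∣ (suc i) ⟩
    2 * (suc i * ℤ.∣ w i ∣)            ∎
    where
    open ≤-Reasoning
    q = quotients w i
    m<n+m/n*n : n < suc (n / suc i) * suc i
    m<n+m/n*n = begin-strict
      n                                    ≡⟨ m≡m%n+[m/n]*n n (suc i) ⟩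
      n % suc i + n / suc i * suc i        <⟨ +-monoˡ-< _ (m%n<n n (suc i)) ⟩
      suc (n / suc i) * suc i              ∎
    regroup : ∀ a b c → a * (16 * (b * c)) ≡ a * (16 * b) * c
    regroup = solve-∀
    regroup′ : ∀ a b → 2 * a * b ≡ 2 * (b * a)
    regroup′ = solve-∀

  sum-quotients≤ : ∀ w → weight n w ≤ 48 * n * n → sumTo n (quotients w) ≤ 6 * n
  sum-quotients≤ w w≤ = *-cancelʳ-≤ _ _ (16 * n) {{m*n≢0 16 n}} (begin
    sumTo n (quotients w) * (16 * n)  ≤⟨ partial n ⟩
    2 * weight n w                    ≤⟨ *-monoʳ-≤ 2 w≤ ⟩
    2 * (48 * n * n)                  ≡⟨ regroup n ⟩
    6 * n * (16 * n)                  ∎)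
    where
    open ≤-Reasoning
    regroup : ∀ a → 2 * (48 * a * a) ≡ 6 * a * (16 * a)
    regroup = solve-∀
    partial : ∀ m → sumTo m (quotients w) * (16 * n) ≤ 2 * weight m w
    partial zero    = z≤n
    partial (suc m) = begin
      (sumTo m (quotients w) + quotients w m) * (16 * n)
        ≡⟨ *-distribʳ-+ (16 * n) (sumTo m (quotients w)) _ ⟩
      sumTo m (quotients w) * (16 * n) + quotients w m * (16 * n)    ≤⟨ +-mono-≤ (partial m) (quotient≤ w m) ⟩
      2 * weight m w + 2 * (suc m * ℤ.∣ w m ∣)                       ≡⟨ *-distribˡ-+ 2 (weight m w) _ ⟨
      2 * weight (suc m) w                                           ∎

  unary<2^7n : ∀ w → weight n w ≤ 48 * n * n → unary n (quotients w) < 2 ^ (7 * n)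
  unary<2^7n w w≤ = <-≤-trans (unary-< n (quotients w)) (^-monoʳ-≤ 2 (+-monoʳ-≤ n (sum-quotients≤ w w≤)))

  codes≤2^13n : radix n n * 2 ^ (7 * n) ≤ 2 ^ (13 * n)
  codes≤2^13n = begin
    radix n n * 2 ^ (7 * n)          ≤⟨ *-monoˡ-≤ (2 ^ (7 * n)) (radix≤ n) ⟩
    2 ^ (6 * n) * 2 ^ (7 * n)        ≡⟨ ^-distribˡ-+-* 2 (6 * n) (7 * n) ⟨
    2 ^ (6 * n + 7 * n)              ≡⟨ cong (2 ^_) (*-distribʳ-+ n 6 7) ⟨
    2 ^ (13 * n)                     ∎
    where open ≤-Reasoning

  abstract
    -- |w i| is split by the modulus base n i ≥ 16n/(i+1): the remainders take
    -- radix n n values and the quotients, written in unary, few bits in total.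
    code : ∀ w → weight n w ≤ 48 * n * n → Fin (2 ^ (13 * n))
    code w w≤ = inject≤ (combine (remainders n n (zigzag ∘ w)) (fromℕ< (unary<2^7n w w≤))) codes≤2^13n

    code-injective : ∀ {w w′} w≤ w′≤ → code w w≤ ≡ code w′ w′≤ → ∀ {i} → i < n → w i ≡ w′ i
    code-injective {w} {w′} w≤ w′≤ eq {i} i<n = zigzag-injective (w i) (w′ i) (begin
      zigzag (w i)                                                   ≡⟨ m≡m%n+[m/n]*n _ (base n i) ⟩
      zigzag (w i) % base n i + quotients w i * base n i             ≡⟨ cong₂ (λ r q → r + q * base n i)
                                                                         (remainders-injective n n rem≡ i<n)
                                                                         (unary-injective n quot≡ i<n) ⟩
      zigzag (w′ i) % base n i + quotients w′ i * base n i           ≡⟨ m≡m%n+[m/n]*n _ (base n i) ⟨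
      zigzag (w′ i)                                                  ∎)
      where
      open ≡-Reasoning
      split : remainders n n (zigzag ∘ w) ≡ remainders n n (zigzag ∘ w′) ×
              fromℕ< (unary<2^7n w w≤) ≡ fromℕ< (unary<2^7n w′ w′≤)
      split = combine-injective (remainders n n (zigzag ∘ w)) _ (remainders n n (zigzag ∘ w′)) _
                (inject≤-injective codes≤2^13n codes≤2^13n _ _ eq)
      rem≡ : remainders n n (zigzag ∘ w) ≡ remainders n n (zigzag ∘ w′)
      rem≡ = proj₁ split
      quot≡ : unary n (quotients w) ≡ unary n (quotients w′)
      quot≡ = fromℕ<-injective _ _ (unary<2^7n w w≤) (unary<2^7n w′ w′≤) (proj₂ split)

-- Nonnegative combinations of integer vectors

sum-mono-≤ : ∀ {p} {f g : Fin p → ℕ} → (∀ j → f j ≤ g j) → sum f ≤ sum g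
sum-mono-≤ {zero}  f≤g = z≤n
sum-mono-≤ {suc p} f≤g = +-mono-≤ (f≤g zero) (sum-mono-≤ (f≤g ∘ suc))

sum-mono-< : ∀ {p} {f g : Fin p → ℕ} → (∀ j → f j ≤ g j) → ∀ e → f e < g e → sum f < sum g
sum-mono-< f≤g zero    fe<ge = +-mono-<-≤ fe<ge (sum-mono-≤ (f≤g ∘ suc))
sum-mono-< f≤g (suc e) fe<ge = +-mono-≤-< (f≤g zero) (sum-mono-< (f≤g ∘ suc) e fe<ge)

term≤sum : ∀ {p} (f : Fin p → ℕ) j → f j ≤ sum f
term≤sum f zero    = m≤m+n _ _
term≤sum f (suc j) = ≤-trans (term≤sum (f ∘ suc) j) (m≤n+m _ _)

sum-const-≤ : ∀ {p c} {f : Fin p → ℕ} → (∀ j → f j ≤ c) → sum f ≤ p * c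
sum-const-≤ {zero}  f≤c = z≤n
sum-const-≤ {suc p} f≤c = +-mono-≤ (f≤c zero) (sum-const-≤ (f≤c ∘ suc))

sum-≡0 : ∀ {p} {f : Fin p → ℕ} → (∀ j → f j ≡ 0) → sum f ≡ 0
sum-≡0 {zero}  f≡0 = refl
sum-≡0 {suc p} f≡0 = cong₂ _+_ (f≡0 zero) (sum-≡0 (f≡0 ∘ suc))

lin : ∀ {p} → (Fin p → ℕ) → (Fin p → ℕ → ℤ) → ℕ → ℤ
lin z α i = ℤΣ.sum (λ j → + z j ℤ.* α j i)

lin-cong : ∀ {p} {x y : Fin p → ℕ} → (∀ j → x j ≡ y j) → ∀ α i → lin x α i ≡ lin y α i
lin-cong x≗y α i = ℤΣ.sum-cong-≗ (λ j → cong (λ t → + t ℤ.* α j i) (x≗y j))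

lin-+ : ∀ {p} (x y : Fin p → ℕ) α i → lin (λ j → x j + y j) α i ≡ lin x α i ℤ.+ lin y α i
lin-+ x y α i = trans
  (ℤΣ.sum-cong-≗ (λ j → trans (cong (ℤ._* α j i) (ℤ.pos-+ (x j) (y j))) (ℤ.*-distribʳ-+ (α j i) (+ x j) (+ y j))))
  (ℤΣ.∑-distrib-+ (λ j → + x j ℤ.* α j i) (λ j → + y j ℤ.* α j i))

lin-* : ∀ {p} m (x : Fin p → ℕ) α i → lin (λ j → m * x j) α i ≡ + m ℤ.* lin x α i
lin-* m x α i = trans
  (ℤΣ.sum-cong-≗ (λ j → trans (cong (ℤ._* α j i) (ℤ.pos-* m (x j))) (ℤ.*-assoc (+ m) (+ x j) (α j i))))
  (sym (ℤΣ.*-distribˡ-sum (+ m) (λ j → + x j ℤ.* α j i)))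

lin-0 : ∀ {p} (α : Fin p → ℕ → ℤ) i → lin (λ _ → 0) α i ≡ 0ℤ
lin-0 {zero}  α i = refl
lin-0 {suc p} α i = trans (ℤ.+-identityˡ _) (lin-0 (α ∘ suc) i)

sumTo-mono-≤ : ∀ n {f g} → (∀ i → f i ≤ g i) → sumTo n f ≤ sumTo n g
sumTo-mono-≤ zero    f≤g = z≤n
sumTo-mono-≤ (suc n) f≤g = +-mono-≤ (sumTo-mono-≤ n f≤g) (f≤g n)

sumTo-+ : ∀ n f g → sumTo n (λ i → f i + g i) ≡ sumTo n f + sumTo n g
sumTo-+ zero    f g = refl
sumTo-+ (suc n) f g = trans (cong (_+ (f n + g n)) (sumTo-+ n f g)) (interchange (sumTo n f) (sumTo n g) (f n) (g n))
  where
  interchange : ∀ a b c d → a + b + (c + d) ≡ a + c + (b + d)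
  interchange = solve-∀

sumTo-* : ∀ n m f → sumTo n (λ i → m * f i) ≡ m * sumTo n f
sumTo-* zero    m f = sym (*-zeroʳ m)
sumTo-* (suc n) m f = trans (cong (_+ m * f n) (sumTo-* n m f)) (sym (*-distribˡ-+ m (sumTo n f) (f n)))

sumTo-zero : ∀ n {f} → (∀ i → f i ≡ 0) → sumTo n f ≡ 0
sumTo-zero zero    f≡0 = refl
sumTo-zero (suc n) f≡0 = cong₂ _+_ (sumTo-zero n f≡0) (f≡0 n)

sumTo-cong : ∀ n {f g} → (∀ {i} → i < n → f i ≡ g i) → sumTo n f ≡ sumTo n g
sumTo-cong zero    f≡g = refl
sumTo-cong (suc n) f≡g = cong₂ _+_ (sumTo-cong n (f≡g ∘ m≤n⇒m≤1+n)) (f≡g ≤-refl)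

weight-+ : ∀ n x y → weight n (λ i → x i ℤ.+ y i) ≤ weight n x + weight n y
weight-+ n x y = ≤-trans
  (sumTo-mono-≤ n (λ i → ≤-trans (*-monoʳ-≤ (suc i) (ℤ.∣i+j∣≤∣i∣+∣j∣ (x i) (y i)))
                                  (≤-reflexive (*-distribˡ-+ (suc i) ℤ.∣ x i ∣ ℤ.∣ y i ∣))))
  (≤-reflexive (sumTo-+ n (λ i → suc i * ℤ.∣ x i ∣) (λ i → suc i * ℤ.∣ y i ∣)))

weight-* : ∀ n m x → weight n (λ i → + m ℤ.* x i) ≡ m * weight n x
weight-* n m x = trans
  (sumTo-cong n (λ {i} _ → trans (cong (suc i *_) (ℤ.abs-* (+ m) (x i))) (x∙yz≈y∙xz (suc i) m ℤ.∣ x i ∣)))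
  (sumTo-* n m (λ i → suc i * ℤ.∣ x i ∣))

weight-lin : ∀ n {p W} (z : Fin p → ℕ) α → (∀ j → weight n (α j) ≤ W) → weight n (lin z α) ≤ sum z * W
weight-lin n {zero}  z α α≤W = ≤-reflexive (sumTo-zero n (*-zeroʳ ∘ suc))
weight-lin n {suc p} {W} z α α≤W = begin
  weight n (lin z α)
    ≤⟨ weight-+ n (λ i → + z zero ℤ.* α zero i) (lin (z ∘ suc) (α ∘ suc)) ⟩
  weight n (λ i → + z zero ℤ.* α zero i) + weight n (lin (z ∘ suc) (α ∘ suc))
    ≡⟨ cong (_+ weight n (lin (z ∘ suc) (α ∘ suc))) (weight-* n (z zero) (α zero)) ⟩
  z zero * weight n (α zero) + weight n (lin (z ∘ suc) (α ∘ suc))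
    ≤⟨ +-mono-≤ (*-monoʳ-≤ (z zero) (α≤W zero)) (weight-lin n (z ∘ suc) (α ∘ suc) (α≤W ∘ suc)) ⟩
  z zero * W + sum (z ∘ suc) * W                                         ≡⟨ *-distribʳ-+ W (z zero) _ ⟨
  sum z * W                                                              ∎
  where open ≤-Reasoning

-- Supports, elimination of a coordinate, and subsets of a support

sgn : ℕ → ℕ
sgn zero    = 0
sgn (suc _) = 1

sgn-mono : ∀ {x y} → (y ≡ 0 → x ≡ 0) → sgn x ≤ sgn y
sgn-mono {zero}          _   = z≤n
sgn-mono {suc x} {zero}  y→x = contradiction (y→x refl) λ()
sgn-mono {suc x} {suc y} _   = ≤-refl

support : ∀ {p} → (Fin p → ℕ) → ℕ
support z = sum (sgn ∘ z)

support-< : ∀ {p} {x y : Fin p → ℕ} → (∀ j → y j ≡ 0 → x j ≡ 0) → ∀ e → x e ≡ 0 → 0 < y e → support x < support y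
support-< {x = x} {y} x⊆y e xe≡0 0<ye = sum-mono-< (λ j → sgn-mono (x⊆y j)) e (strict (x e) (y e) xe≡0 0<ye)
  where
  strict : ∀ a b → a ≡ 0 → 0 < b → sgn a < sgn b
  strict _ (suc _) refl _ = ≤-refl

-- An index e minimising the ratio z e / c e over the support of c.
pivot : ∀ {p} (z c : Fin p → ℕ) → (∀ j → c j ≡ 0) ⊎ ∃ λ e → 0 < c e × (∀ j → z e * c j ≤ c e * z j)
pivot {zero}  z c = inj₁ λ()
pivot {suc p} z c with pivot (z ∘ suc) (c ∘ suc) | c zero in c₀≡
... | inj₁ c≡0 | zero  = inj₁ λ { zero → c₀≡ ; (suc j) → c≡0 j }
... | inj₁ c≡0 | suc _ = inj₂ (zero , subst (0 <_) (sym c₀≡) z<s , λ where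
      zero    → ≤-reflexive (*-comm (z zero) (c zero))
      (suc j) → ≤-trans (≤-reflexive (trans (cong (z zero *_) (c≡0 j)) (*-zeroʳ (z zero)))) z≤n)
... | inj₂ (e , 0<ce , min) | zero = inj₂ (suc e , 0<ce , λ where
      zero    → ≤-trans (≤-reflexive (trans (cong (z (suc e) *_) c₀≡) (*-zeroʳ (z (suc e))))) z≤n
      (suc j) → min j)
... | inj₂ (e , 0<ce , min) | suc _ with z (suc e) * c zero ≤? c (suc e) * z zero
...   | yes ≤₀ = inj₂ (suc e , 0<ce , λ { zero → ≤₀ ; (suc j) → min j })
...   | no ≰₀  = inj₂ (zero , subst (0 <_) (sym c₀≡) z<s , λ where
      zero    → ≤-reflexive (*-comm (z zero) (c zero))
      (suc j) → *-cancelˡ-≤ (c (suc e)) {{>-nonZero 0<ce}} (begin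
        c (suc e) * (z zero * c (suc j))     ≡⟨ *-assoc (c (suc e)) (z zero) _ ⟨
        c (suc e) * z zero * c (suc j)       ≤⟨ *-monoˡ-≤ (c (suc j)) (≰⇒≥ ≰₀) ⟩
        z (suc e) * c zero * c (suc j)       ≡⟨ xy∙z≈y∙xz (z (suc e)) (c zero) (c (suc j)) ⟩
        c zero * (z (suc e) * c (suc j))     ≤⟨ *-monoʳ-≤ (c zero) (min j) ⟩
        c zero * (c (suc e) * z (suc j))     ≡⟨ x∙yz≈y∙xz (c zero) (c (suc e)) (z (suc j)) ⟩
        c (suc e) * (c zero * z (suc j))     ∎))
  where
  open ≤-Reasoning

-- Starting at `z`, move in the direction x - y until the first coordinate, `e`, reaches zero; the
-- step length is z e / (y e - x e). The result is scaled by this denominator, and the equation is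
-- rearranged to avoid subtraction.
eliminate : ∀ {p} (z x y : Fin p → ℕ) → (∃ λ j → x j < y j) →
            ∃ λ e → ∃ λ z′ → x e < y e × z′ e ≡ 0 ×
            (∀ j → z′ j + z e * y j ≡ (y e ∸ x e) * z j + z e * x j)
-- Truncated subtraction is nonzero exactly at the decreasing coordinates, so only these compete for
-- the minimal ratio.
eliminate z x y (f , xf<yf) with pivot z (λ j → y j ∸ x j)
... | inj₁ y∸x≡0 = contradiction (m∸n≡0⇒m≤n (y∸x≡0 f)) (<⇒≱ xf<yf)
... | inj₂ (e , 0<ye∸xe , min) =
  e , (λ j → D * z j + z e * x j ∸ z e * y j) , xe<ye , vanish , λ j → m∸n+n≡m (enough j)
  where
  open ≤-Reasoning
  D = y e ∸ x e
  xe<ye : x e < y e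
  xe<ye = ≰⇒> λ ye≤xe → <⇒≢ 0<ye∸xe (sym (m≤n⇒m∸n≡0 ye≤xe))
  enough : ∀ j → z e * y j ≤ D * z j + z e * x j
  enough j = begin
    z e * y j                             ≤⟨ *-monoʳ-≤ (z e) (m≤n+m∸n (y j) (x j)) ⟩
    z e * (x j + (y j ∸ x j))             ≡⟨ *-distribˡ-+ (z e) (x j) _ ⟩
    z e * x j + z e * (y j ∸ x j)         ≤⟨ +-monoʳ-≤ (z e * x j) (min j) ⟩
    z e * x j + D * z j                   ≡⟨ +-comm (z e * x j) _ ⟩
    D * z j + z e * x j                   ∎
  vanish : D * z e + z e * x e ∸ z e * y e ≡ 0
  vanish = m≤n⇒m∸n≡0 (≤-reflexive (begin-equality
    D * z e + z e * x e     ≡⟨ cong (_+ z e * x e) (*-comm D (z e)) ⟩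
    z e * D + z e * x e     ≡⟨ *-distribˡ-+ (z e) D (x e) ⟨
    z e * (D + x e)         ≡⟨ cong (z e *_) (m∸n+n≡m (<⇒≤ xe<ye)) ⟩
    z e * y e               ∎))

-- There is one bit for each of the first `K` positions of the support of `z`. Surplus bits are
-- ignored when the support is smaller, which is why injectivity asks for `K ≤ support z`.
record Subsets {p} (K : ℕ) (z : Fin p → ℕ) : Set where
  field
    subset    : (Fin K → Fin 2) → Fin p → ℕ
    subset⊆   : ∀ X j → z j ≡ 0 → subset X j ≡ 0
    subset≤1  : ∀ X j → subset X j ≤ 1
    sum≤      : ∀ X → sum (subset X) ≤ K
    injective : K ≤ support z → ∀ {X Y} → (∀ j → subset X j ≡ subset Y j) → ∀ x → X x ≡ Y x

subsets : ∀ {p} K (z : Fin p → ℕ) → Subsets K z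
subsets {zero} K z = record
  { subset    = λ _ ()
  ; subset⊆   = λ _ ()
  ; subset≤1  = λ _ ()
  ; sum≤      = λ _ → z≤n
  ; injective = λ { z≤n _ () }
  }
subsets {suc p} K z with z zero in z₀≡
... | zero = record
  { subset    = λ { X zero → 0 ; X (suc j) → subset X j }
  ; subset⊆   = λ { X zero _ → refl ; X (suc j) → subset⊆ X j }
  ; subset≤1  = λ { X zero → z≤n ; X (suc j) → subset≤1 X j }
  ; sum≤      = sum≤
  ; injective = λ K≤ eq → injective (subst (λ s → K ≤ sgn s + support (z ∘ suc)) z₀≡ K≤) (eq ∘ suc)
  }
  where open Subsets (subsets K (z ∘ suc))
subsets {suc p} zero z | suc _ = record
  { subset    = λ _ _ → 0
  ; subset⊆   = λ _ _ _ → refl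
  ; subset≤1  = λ _ _ → z≤n
  ; sum≤      = λ _ → ≤-reflexive (sum-≡0 {p} (λ _ → refl))
  ; injective = λ { _ _ () }
  }
subsets {suc p} (suc K) z | suc _ = record
  { subset    = λ { X zero → toℕ (X zero) ; X (suc j) → subset (X ∘ suc) j }
  ; subset⊆   = λ { X zero z₀≡0 → contradiction (trans (sym z₀≡) z₀≡0) λ() ; X (suc j) → subset⊆ (X ∘ suc) j }
  ; subset≤1  = λ { X zero → s≤s⁻¹ (toℕ<n (X zero)) ; X (suc j) → subset≤1 (X ∘ suc) j }
  ; sum≤      = λ X → +-mono-≤ (s≤s⁻¹ (toℕ<n (X zero))) (sum≤ (X ∘ suc))
  ; injective = λ { K≤ eq zero    → toℕ-injective (eq zero)
                  ; K≤ eq (suc x) → injective (s≤s⁻¹ (subst (λ s → suc K ≤ sgn s + support (z ∘ suc)) z₀≡ K≤)) (eq ∘ suc) x }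
  }
  where
  open Subsets (subsets K (z ∘ suc))

-- Circuits

funToFin-cong : ∀ {m n} {f g : Fin m → Fin n} → (∀ x → f x ≡ g x) → funToFin f ≡ funToFin g
funToFin-cong {zero}  f≗g = refl
funToFin-cong {suc m} f≗g = cong₂ combine (f≗g zero) (funToFin-cong (f≗g ∘ suc))

finToFun-injective : ∀ {m n} {i j : Fin (n ^ m)} → (∀ x → finToFun {n} {m} i x ≡ finToFun j x) → i ≡ j
finToFun-injective {m} {n} {i} {j} eq = begin
  i                     ≡⟨ funToFin-finToFin {m} {n} i ⟨
  funToFin (finToFun {n} {m} i) ≡⟨ funToFin-cong eq ⟩
  funToFin (finToFun {n} {m} j) ≡⟨ funToFin-finToFin {m} {n} j ⟩
  j                     ∎
  where open ≡-Reasoning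

∣-∣-cancel : ∀ x y → x ℤ.+ y ≡ 0ℤ → ℤ.∣ x ∣ ≡ ℤ.∣ y ∣
∣-∣-cancel x y x+y≡0 = trans (cong ℤ.∣_∣ (inverseˡ-unique x y x+y≡0)) (ℤ.∣-i∣≡∣i∣ y)

module _ (n : ℕ) .{{_ : NonZero n}} {p} (α : Fin p → ℕ → ℤ) (light : ∀ j → weight n (α j) ≤ 3 * n) where

  SameSum : (x y : Fin p → ℕ) → Set
  SameSum x y = ∀ {i} → i < n → lin x α i ≡ lin y α i

  Balanced : (Fin p → ℕ) → Set
  Balanced z = ∀ {i} → i < n → lin z α i ≡ 0ℤ

  -- The identity says z′ = D z + m (x - y) without subtraction, and x - y contributes zero. Every
  -- balanced vector formed below by subtraction or elimination is an instance.
  balanced-cancel : ∀ (z z′ x y : Fin p → ℕ) D m → (∀ j → z′ j + m * y j ≡ D * z j + m * x j) →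
                    Balanced z → SameSum x y → Balanced z′
  balanced-cancel z z′ x y D m eq Bz x≈y {i} i<n = ∙-cancelʳ (+ m ℤ.* lin y α i) _ _ (begin
    lin z′ α i ℤ.+ + m ℤ.* lin y α i              ≡⟨ cong (ℤ._+_ (lin z′ α i)) (lin-* m y α i) ⟨
    lin z′ α i ℤ.+ lin (λ j → m * y j) α i        ≡⟨ lin-+ z′ (λ j → m * y j) α i ⟨
    lin (λ j → z′ j + m * y j) α i                ≡⟨ lin-cong eq α i ⟩
    lin (λ j → D * z j + m * x j) α i             ≡⟨ lin-+ (λ j → D * z j) (λ j → m * x j) α i ⟩
    lin (λ j → D * z j) α i ℤ.+ lin (λ j → m * x j) α i ≡⟨ cong₂ ℤ._+_ (lin-* D z α i) (lin-* m x α i) ⟩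
    + D ℤ.* lin z α i ℤ.+ + m ℤ.* lin x α i       ≡⟨ cong₂ (λ a b → + D ℤ.* a ℤ.+ + m ℤ.* b) (Bz i<n) (x≈y i<n) ⟩
    + D ℤ.* 0ℤ ℤ.+ + m ℤ.* lin y α i              ≡⟨ cong (ℤ._+ + m ℤ.* lin y α i) (ℤ.*-zeroʳ (+ D)) ⟩
    0ℤ ℤ.+ + m ℤ.* lin y α i                      ∎)
    where open ≡-Reasoning

  balanced-0 : Balanced (λ _ → 0)
  balanced-0 {i} _ = lin-0 α i

  balanced-∸ : ∀ x y → (∀ j → x j ≤ y j) → SameSum x y → Balanced (λ j → y j ∸ x j)
  balanced-∸ x y x≤y x≈y = balanced-cancel (λ _ → 0) (λ j → y j ∸ x j) y x 0 1 (λ j → begin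
    y j ∸ x j + 1 * x j  ≡⟨ cong (_+_ (y j ∸ x j)) (*-identityˡ (x j)) ⟩
    y j ∸ x j + x j      ≡⟨ m∸n+n≡m (x≤y j) ⟩
    y j                  ≡⟨ *-identityˡ (y j) ⟨
    1 * y j              ∎) balanced-0 (λ i<n → sym (x≈y i<n))
    where open ≡-Reasoning

  record Circuit (z : Fin p → ℕ) : Set where
    field
      circuit  : Fin p → ℕ
      balanced : Balanced circuit
      nonzero  : ∃ λ j → 0 < circuit j
      ⊆z       : ∀ j → z j ≡ 0 → circuit j ≡ 0
      small    : ∀ j → circuit j ≤ 2 ^ (13 * n)

  difference : ∀ (z x y : Fin p → ℕ) → (∀ j → x j ≤ y j) → (∃ λ j → x j < y j) → SameSum x y →
               (∀ j → z j ≡ 0 → y j ≡ 0) → (∀ j → y j ≤ 2 ^ (13 * n)) → Circuit z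
  difference z x y x≤y (j , xj<yj) x≈y y⊆z y≤ = record
    { circuit  = λ j → y j ∸ x j
    ; balanced = balanced-∸ x y x≤y x≈y
    ; nonzero  = j , m<n⇒0<n∸m xj<yj
    ; ⊆z       = λ j zj≡0 → trans (cong (_∸ x j) (y⊆z j zj≡0)) (0∸n≡0 (x j))
    ; small    = λ j → ≤-trans (m∸n≤m (y j) (x j)) (y≤ j)
    }

  abstract
    collision : ∀ {N} (x : Fin N → Fin p → ℕ) → 2 ^ (13 * n) < N →
                (∀ t → weight n (lin (x t) α) ≤ 48 * n * n) →
                ∃₂ λ s t → s Fin.< t × SameSum (x s) (x t)
    collision x N> w≤ =
      let s , t , s<t , eq = pigeonhole N> (λ t → code n (lin (x t) α) (w≤ t))
      in s , t , s<t , code-injective n {lin (x s) α} {lin (x t) α} (w≤ s) (w≤ t) eq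

  -- When z has small support, the roundings ⌊t z / M⌋ for M = max z and
  -- t = 0, 1, 2, … are all nearly balanced, and two of them collide.
  round-at : ∀ z → Balanced z → support z ≤ 16 * n → ∀ m → 0 < z m → (∀ j → z j ≤ z m) → Circuit z
  round-at z Bz supp≤ m 0<zm max =
    let s , t , s<t , same = collision {N = suc (2 ^ (13 * n))} (λ t → q (toℕ t)) (n<1+n _) (λ t → light-q (toℕ t))
    in difference z (q (toℕ s)) (q (toℕ t))
         (λ j → /-monoˡ-≤ (z m) (*-monoˡ-≤ (z j) (<⇒≤ s<t)))
         -- At the maximal entry `m` the rounding with parameter t is exactly t, so the two
         -- roundings differ there.
         (m , subst₂ _<_ (sym (m*n/n≡m (toℕ s) (z m))) (sym (m*n/n≡m (toℕ t) (z m))) s<t)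
         same (q⊆z (toℕ t)) (λ j → ≤-trans (q≤ (toℕ t) j) (s≤s⁻¹ (toℕ<n t)))
    where
    instance
      zm≢0 : NonZero (z m)
      zm≢0 = >-nonZero 0<zm
    q r : ℕ → Fin p → ℕ
    q t j = t * z j / z m
    r t j = t * z j % z m
    q⊆z : ∀ t j → z j ≡ 0 → q t j ≡ 0
    q⊆z t j zj≡0 = trans (cong (λ x → t * x / z m) zj≡0) (trans (cong (_/ z m) (*-zeroʳ t)) (0/n≡0 (z m)))
    q≤ : ∀ t j → q t j ≤ t
    q≤ t j = ≤-trans (/-monoˡ-≤ (z m) (*-monoʳ-≤ t (max j))) (≤-reflexive (m*n/n≡m t (z m)))
    r≤ : ∀ t j → r t j ≤ z m * sgn (z j)
    r≤ t j with z j
    ... | zero  = ≤-reflexive (trans (cong (_% z m) (*-zeroʳ t)) (trans (m<n⇒m%n≡m 0<zm) (sym (*-zeroʳ (z m)))))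
    ... | suc x = ≤-trans (m%n≤n (t * suc x) (z m)) (≤-reflexive (sym (*-identityʳ (z m))))
    -- Quotients and remainders recombine to t z, which is balanced. So the sum of the roundings,
    -- times z m, weighs as much as the sum of the remainders, and the latter is controlled by the
    -- support.
    split : ∀ t i → i < n → + z m ℤ.* lin (q t) α i ℤ.+ lin (r t) α i ≡ 0ℤ
    split t i i<n = begin
      + z m ℤ.* lin (q t) α i ℤ.+ lin (r t) α i        ≡⟨ cong (ℤ._+ lin (r t) α i) (lin-* (z m) (q t) α i) ⟨
      lin (λ j → z m * q t j) α i ℤ.+ lin (r t) α i    ≡⟨ lin-+ (λ j → z m * q t j) (r t) α i ⟨
      lin (λ j → z m * q t j + r t j) α i              ≡⟨ lin-cong divide α i ⟩
      lin (λ j → t * z j) α i                          ≡⟨ lin-* t z α i ⟩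
      + t ℤ.* lin z α i                                ≡⟨ cong (+ t ℤ.*_) (Bz i<n) ⟩
      + t ℤ.* 0ℤ                                       ≡⟨ ℤ.*-zeroʳ (+ t) ⟩
      0ℤ                                               ∎
      where
      open ≡-Reasoning
      divide : ∀ j → z m * q t j + r t j ≡ t * z j
      divide j = begin
        z m * q t j + r t j   ≡⟨ +-comm (z m * q t j) (r t j) ⟩
        r t j + z m * q t j   ≡⟨ cong (_+_ (r t j)) (*-comm (z m) (q t j)) ⟩
        r t j + q t j * z m   ≡⟨ m≡m%n+[m/n]*n (t * z j) (z m) ⟨
        t * z j               ∎
    open ≤-Reasoning
    light-q : ∀ t → weight n (lin (q t) α) ≤ 48 * n * n
    light-q t = *-cancelˡ-≤ (z m) (begin
      z m * weight n (lin (q t) α)                    ≡⟨ weight-* n (z m) (lin (q t) α) ⟨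
      weight n (λ i → + z m ℤ.* lin (q t) α i)
        ≡⟨ sumTo-cong n (λ {i} i<n → cong (suc i *_) (∣-∣-cancel (+ z m ℤ.* lin (q t) α i) (lin (r t) α i) (split t i i<n))) ⟩
      weight n (lin (r t) α)                          ≤⟨ weight-lin n (r t) α light ⟩
      sum (r t) * (3 * n)                             ≤⟨ *-monoˡ-≤ (3 * n) (sum-mono-≤ (r≤ t)) ⟩
      sum (λ j → z m * sgn (z j)) * (3 * n)           ≡⟨ cong (_* (3 * n)) (*-distribˡ-sum (z m) (sgn ∘ z)) ⟨
      z m * support z * (3 * n)                       ≤⟨ *-monoˡ-≤ (3 * n) (*-monoʳ-≤ (z m) supp≤) ⟩
      z m * (16 * n) * (3 * n)                        ≡⟨ regroup (z m) n ⟩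
      z m * (48 * n * n)                              ∎)
      where
      regroup : ∀ a b → a * (16 * b) * (3 * b) ≡ a * (48 * b * b)
      regroup = solve-∀

  round : ∀ z → Balanced z → (∃ λ m → 0 < z m) → support z ≤ 16 * n → Circuit z
  round z Bz (m₀ , 0<zm₀) supp≤ with pivot (λ _ → 1) z
  ... | inj₁ z≡0              = contradiction (z≡0 m₀) (m<n⇒n≢0 0<zm₀)
  ... | inj₂ (m , 0<zm , max) = round-at z Bz supp≤ m 0<zm λ j → subst₂ _≤_ (*-identityˡ (z j)) (*-identityʳ (z m)) (max j)

  EqualSubsets : (z : Fin p → ℕ) → Set
  EqualSubsets z = ∃₂ λ x y → SameSum x y × (∃ λ j → x j ≢ y j) ×
                   ((∀ j → x j ≤ 1) × (∀ j → y j ≤ 1)) ×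
                   (∀ j → z j ≡ 0 → x j ≡ 0) × (∀ j → z j ≡ 0 → y j ≡ 0)

  -- The 2^(16n) subsets of 16n indices from the support outnumber the codes of their sums.
  equal-subsets : ∀ z → 16 * n ≤ support z → EqualSubsets z
  equal-subsets z ≤supp =
    let s , t , s<t , same = collision {N = 2 ^ (16 * n)} x 2^13n<2^16n light-x
    in x s , x t , same
       , ¬∀⟶∃¬ p _ (λ j → x s j ℕ.≟ x t j)
           (λ eq → Fin.<⇒≢ s<t (finToFun-injective {16 * n} {2} (injective ≤supp eq)))
       , (subset≤1 (finToFun s) , subset≤1 (finToFun t))
       , subset⊆ (finToFun s) , subset⊆ (finToFun t)
    where
    open Subsets (subsets (16 * n) z)
    open ≤-Reasoning
    2^13n<2^16n : 2 ^ (13 * n) < 2 ^ (16 * n)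
    2^13n<2^16n = ^-monoʳ-< 2 (s≤s (s≤s z≤n)) (*-monoˡ-< n {13} {16} (m≤m+n 14 2))
    x : Fin (2 ^ (16 * n)) → Fin p → ℕ
    x t = subset (finToFun t)
    light-x : ∀ t → weight n (lin (x t) α) ≤ 48 * n * n
    light-x t = begin
      weight n (lin (x t) α)    ≤⟨ weight-lin n (x t) α light ⟩
      sum (x t) * (3 * n)       ≤⟨ *-monoˡ-≤ (3 * n) (sum≤ (finToFun t)) ⟩
      16 * n * (3 * n)          ≡⟨ regroup n ⟩
      48 * n * n                ∎
      where
      regroup : ∀ b → 16 * b * (3 * b) ≡ 48 * b * b
      regroup = solve-∀

  -- Induction on the bound for the support. A small support allows rounding. In a large one two
  -- subsets have equal sums: if they are comparable, their difference is a circuit; if not, it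
  -- serves as a direction in which a coordinate of `z` can be eliminated, and a circuit of the
  -- result is one of `z`.
  circuit-within : ∀ s z → support z ≤ s → Balanced z → (∃ λ m → 0 < z m) → Circuit z
  circuit-by-subsets : ∀ s z → support z ≤ suc s → Balanced z → EqualSubsets z → Circuit z
  circuit-by-elimination :
    ∀ s z → support z ≤ suc s → Balanced z → ∀ x y → SameSum x y → (∀ j → x j ≤ 1) →
    (∀ j → z j ≡ 0 → x j ≡ 0) → (∀ j → z j ≡ 0 → y j ≡ 0) →
    (∃ λ j → x j < y j) → (∃ λ j → y j < x j) → Circuit z

  circuit-within zero    z supp≤ Bz pos = round z Bz pos (≤-trans supp≤ z≤n)
  circuit-within (suc s) z supp≤ Bz pos with ≤-total (support z) (16 * n)
  ... | inj₁ ≤16n = round z Bz pos ≤16n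
  ... | inj₂ 16n≤ = circuit-by-subsets s z supp≤ Bz (equal-subsets z 16n≤)

  circuit-by-subsets s z supp≤ Bz (x , y , same , (j , xj≢yj) , (x≤1 , y≤1) , x⊆z , y⊆z)
    with any? (λ j → x j <? y j) | any? (λ j → y j <? x j)
  ... | no x≮y  | _       = difference z y x (λ j → ≮⇒≥ (x≮y ∘ (j ,_))) (j , ≤∧≢⇒< (≮⇒≥ (x≮y ∘ (j ,_))) (xj≢yj ∘ sym))
                              (sym ∘ same) x⊆z (λ j → ≤-trans (x≤1 j) (m^n>0 2 (13 * n)))
  ... | yes x<y | no y≮x  = difference z x y (λ j → ≮⇒≥ (y≮x ∘ (j ,_))) x<y
                              same y⊆z (λ j → ≤-trans (y≤1 j) (m^n>0 2 (13 * n)))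
  ... | yes x<y | yes y<x = circuit-by-elimination s z supp≤ Bz x y same x≤1 x⊆z y⊆z x<y y<x

  circuit-by-elimination s z supp≤ Bz x y same x≤1 x⊆z y⊆z x<y (f , yf<xf)
    with e , z′ , xe<ye , z′e≡0 , eq ← eliminate z x y x<y
    = record
      { circuit  = circuit
      ; balanced = balanced
      ; nonzero  = nonzero
      ; ⊆z       = λ j → ⊆z j ∘ z′⊆z j
      ; small    = small
      }
    where
    open ≤-Reasoning
    z-pos : ∀ {w : Fin p → ℕ} → (∀ j → z j ≡ 0 → w j ≡ 0) → ∀ j → 0 < w j → 0 < z j
    z-pos w⊆z j 0<wj = n≢0⇒n>0 (λ zj≡0 → <-irrefl (sym (w⊆z j zj≡0)) 0<wj)
    D = y e ∸ x e
    z′⊆z : ∀ j → z j ≡ 0 → z′ j ≡ 0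
    z′⊆z j zj≡0 = m+n≡0⇒m≡0 (z′ j) (begin-equality
      z′ j + z e * y j          ≡⟨ eq j ⟩
      D * z j + z e * x j       ≡⟨ cong₂ (λ a b → D * a + z e * b) zj≡0 (x⊆z j zj≡0) ⟩
      D * 0 + z e * 0           ≡⟨ cong₂ _+_ (*-zeroʳ D) (*-zeroʳ (z e)) ⟩
      0                         ∎)
    -- Where `x` exceeds `y`, the bound 1 on `x` leaves nothing for `y` to subtract. Coordinate `f`
    -- therefore stays positive, and `z′` is again nonzero.
    yf≡0 : y f ≡ 0
    yf≡0 = n<1⇒n≡0 (<-≤-trans yf<xf (x≤1 f))
    z′f>0 : 0 < z′ f
    z′f>0 = begin-strict
      0                      <⟨ *-mono-≤ (m<n⇒0<n∸m xe<ye) (z-pos x⊆z f (≤-<-trans z≤n yf<xf)) ⟩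
      D * z f                ≤⟨ m≤m+n (D * z f) _ ⟩
      D * z f + z e * x f    ≡⟨ eq f ⟨
      z′ f + z e * y f       ≡⟨ cong (λ a → z′ f + z e * a) yf≡0 ⟩
      z′ f + z e * 0         ≡⟨ cong (_+_ (z′ f)) (*-zeroʳ (z e)) ⟩
      z′ f + 0               ≡⟨ +-identityʳ (z′ f) ⟩
      z′ f                   ∎
    open Circuit (circuit-within s z′
      (s≤s⁻¹ (<-≤-trans (support-< z′⊆z e z′e≡0 (z-pos y⊆z e (≤-<-trans z≤n xe<ye))) supp≤))
      (balanced-cancel z z′ x y D (z e) eq Bz same) (f , z′f>0))

  -- Circuits that fit below a balanced vector

  maxEntry : ℕ
  maxEntry = 2 ^ (13 * n)

  -- A circuit that does not fit D times below z is used to eliminate a coordinate of z;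
  -- z c stays large because the circuit has small entries.
  circuit-below : ∀ s z D → support z ≤ s → Balanced z → ∀ c → D * (s * maxEntry) < z c →
                  Σ[ C ∈ Circuit z ] (∀ j → D * Circuit.circuit C j ≤ z j)
  -- Elimination with x = 0 and y = C gives z′ = C e · z - z e · C, where `e` minimises z e / C e.
  -- If D · C fits at `e`, it fits everywhere by minimality. Otherwise recurse on `z′` with the
  -- factor C e · D: what fits that often below z′ ≤ C e · z fits D times below `z`. This rescaling
  -- is why the statement carries a factor `D`.
  circuit-below-by-elimination :
    ∀ s z D → support z ≤ suc s → Balanced z → ∀ c → D * (suc s * maxEntry) < z c → (C : Circuit z) →
    (∃ λ e → ∃ λ z′ → 0 < Circuit.circuit C e × z′ e ≡ 0 ×
      (∀ j → z′ j + z e * Circuit.circuit C j ≡ Circuit.circuit C e * z j + z e * 0)) →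
    Σ[ C ∈ Circuit z ] (∀ j → D * Circuit.circuit C j ≤ z j)

  circuit-below zero z D supp≤ Bz c large =
    contradiction (≤-trans (≤-trans (sgn-pos large) (term≤sum (sgn ∘ z) c)) supp≤) λ()
    where
    sgn-pos : ∀ {a b} → a < b → 1 ≤ sgn b
    sgn-pos {b = suc _} _ = ≤-refl
  circuit-below (suc s) z D supp≤ Bz c large =
    circuit-below-by-elimination s z D supp≤ Bz c large C (eliminate z (λ _ → 0) (Circuit.circuit C) (Circuit.nonzero C))
    where
    C : Circuit z
    C = circuit-within (suc s) z supp≤ Bz (c , ≤-<-trans z≤n large)

  circuit-below-by-elimination s z D supp≤ Bz c large C (e , z′ , 0<Ce , z′e≡0 , eq)
    with D * Circuit.circuit C e ≤? z e
  ... | yes fits = C , λ j → *-cancelˡ-≤ (circuit e) {{>-nonZero 0<Ce}} (begin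
    circuit e * (D * circuit j)       ≡⟨ x∙yz≈yx∙z (circuit e) D (circuit j) ⟩
    D * circuit e * circuit j         ≤⟨ *-monoˡ-≤ (circuit j) fits ⟩
    z e * circuit j                   ≤⟨ m≤n+m _ (z′ j) ⟩
    z′ j + z e * circuit j            ≡⟨ eq′ j ⟩
    circuit e * z j                   ∎)
    where
    open Circuit C
    open ≤-Reasoning
    eq′ : ∀ j → z′ j + z e * circuit j ≡ circuit e * z j
    eq′ j = trans (eq j) (trans (cong (_+_ (circuit e * z j)) (*-zeroʳ (z e))) (+-identityʳ _))
  ... | no ¬fits = below (circuit-below s z′ (circuit e * D)
          (s≤s⁻¹ (<-≤-trans (support-< z′⊆z e z′e≡0 0<ze) supp≤))
          (balanced-cancel z z′ (λ _ → 0) circuit (circuit e) (z e) eq Bz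
            (λ {i} i<n → trans (balanced-0 i<n) (sym (balanced i<n)))) c large′)
    where
    open Circuit C
    open ≤-Reasoning
    eq′ : ∀ j → z′ j + z e * circuit j ≡ circuit e * z j
    eq′ j = trans (eq j) (trans (cong (_+_ (circuit e * z j)) (*-zeroʳ (z e))) (+-identityʳ _))
    0<ze : 0 < z e
    0<ze = n≢0⇒n>0 (λ ze≡0 → <-irrefl (sym (⊆z e ze≡0)) 0<Ce)
    z′⊆z : ∀ j → z j ≡ 0 → z′ j ≡ 0
    z′⊆z j zj≡0 = m+n≡0⇒m≡0 (z′ j) (trans (eq′ j) (trans (cong (circuit e *_) zj≡0) (*-zeroʳ (circuit e))))
    -- As C does not fit at `e`, the loss z e · C c is at most D · C e · `maxEntry`, which is the
    -- share of a single support element in the budget `suc s`.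
    large′ : circuit e * D * (s * maxEntry) < z′ c
    large′ = +-cancelʳ-< (z e * circuit c) _ _ (begin-strict
      circuit e * D * (s * maxEntry) + z e * circuit c
        ≤⟨ +-monoʳ-≤ _ (*-mono-≤ (<⇒≤ (≰⇒> ¬fits)) (small c)) ⟩
      circuit e * D * (s * maxEntry) + D * circuit e * maxEntry           ≡⟨ regroup (circuit e) D s maxEntry ⟩
      circuit e * (D * (suc s * maxEntry))                         <⟨ *-monoʳ-< (circuit e) {{>-nonZero 0<Ce}} large ⟩
      circuit e * z c                                       ≡⟨ eq′ c ⟨
      z′ c + z e * circuit c                                ∎)
      where
      regroup : ∀ a d s b → a * d * (s * b) + d * a * b ≡ a * (d * (suc s * b))
      regroup = solve-∀
    below : Σ[ C′ ∈ Circuit z′ ] (∀ j → circuit e * D * Circuit.circuit C′ j ≤ z′ j) →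
            Σ[ C′ ∈ Circuit z ] (∀ j → D * Circuit.circuit C′ j ≤ z j)
    below (C′ , C′≤) =
      record { circuit = Circuit.circuit C′ ; balanced = Circuit.balanced C′ ; nonzero = Circuit.nonzero C′
             ; ⊆z = λ j → Circuit.⊆z C′ j ∘ z′⊆z j ; small = Circuit.small C′ }
      , λ j → *-cancelˡ-≤ (circuit e) {{>-nonZero 0<Ce}} (begin
          circuit e * (D * Circuit.circuit C′ j)    ≡⟨ *-assoc (circuit e) D _ ⟨
          circuit e * D * Circuit.circuit C′ j      ≤⟨ C′≤ j ⟩
          z′ j                                      ≤⟨ m≤m+n (z′ j) _ ⟩
          z′ j + z e * circuit j                    ≡⟨ eq′ j ⟩
          circuit e * z j                           ∎)

  support≤p : ∀ (z : Fin p → ℕ) → support z ≤ p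
  support≤p z = ≤-trans (sum-const-≤ (λ j → sgn≤1 (z j))) (≤-reflexive (*-identityʳ p))
    where
    sgn≤1 : ∀ a → sgn a ≤ 1
    sgn≤1 zero    = z≤n
    sgn≤1 (suc _) = ≤-refl

  -- While some entry is large, a circuit fits below `z`. If it meets `c`, it is the vector sought.
  -- If not, subtracting it leaves z c intact and lowers the total, which `t` bounds.
  small-balanced-below : ∀ t z → sum z ≤ t → Balanced z → ∀ c → 0 < z c →
    ∃ λ y → Balanced y × 0 < y c × (∀ j → y j ≤ z j) × (∀ j → y j ≤ p * maxEntry)
  small-balanced-below zero z sum≤ Bz c 0<zc = contradiction (≤-trans 0<zc (≤-trans (term≤sum z c) sum≤)) λ()
  small-balanced-below (suc t) z sum≤ Bz c 0<zc with any? (λ j → p * maxEntry <? z j)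
  ... | no ¬large = z , Bz , 0<zc , (λ _ → ≤-refl) , λ j → ≮⇒≥ (¬large ∘ (j ,_))
  ... | yes (d , large) = remove (circuit-below p z 1 (support≤p z) Bz d
      (subst (_< z d) (sym (*-identityˡ (p * maxEntry))) large))
    where
    remove : Σ[ C ∈ Circuit z ] (∀ j → 1 * Circuit.circuit C j ≤ z j) →
             ∃ λ y → Balanced y × 0 < y c × (∀ j → y j ≤ z j) × (∀ j → y j ≤ p * maxEntry)
    remove (C , 1*C≤z) with Circuit.circuit C c ℕ.≟ 0
    ... | no Cc≢0 = circuit , balanced , n≢0⇒n>0 Cc≢0 , C≤z , λ j → ≤-trans (small j) (m≤n*m maxEntry p {{nonZeroIndex c}})
      where
      open Circuit C
      C≤z : ∀ j → circuit j ≤ z j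
      C≤z j = subst (_≤ z j) (*-identityˡ (circuit j)) (1*C≤z j)
      nonZeroIndex : ∀ {q} → Fin q → NonZero q
      nonZeroIndex {suc q} _ = _
    ... | yes Cc≡0 =
      let y , By , 0<yc , y≤ , y≤pB = small-balanced-below t (λ j → z j ∸ circuit j) sum≤t
                                        (balanced-∸ circuit z C≤z (λ i<n → trans (balanced i<n) (sym (Bz i<n)))) c
                                        (subst (λ a → 0 < z c ∸ a) (sym Cc≡0) 0<zc)
      in y , By , 0<yc , (λ j → ≤-trans (y≤ j) (m∸n≤m (z j) (circuit j))) , y≤pB
      where
      open Circuit C
      C≤z : ∀ j → circuit j ≤ z j
      C≤z j = subst (_≤ z j) (*-identityˡ (circuit j)) (1*C≤z j)
      sum≤t : sum (λ j → z j ∸ circuit j) ≤ t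
      sum≤t = let f , 0<Cf = nonzero in
        s≤s⁻¹ (<-≤-trans (sum-mono-< (λ j → m∸n≤m (z j) (circuit j)) f (∸-monoʳ-< 0<Cf (C≤z f))) sum≤)

-- Balanced subfamilies

ind : Bool → ℕ
ind b = if b then 1 else 0

unit : ∀ {p} → Fin p → Fin p → ℕ
unit j k = ind (does (j ≟ k))

unit-refl : ∀ {p} (j : Fin p) → unit j j ≡ 1
unit-refl j = cong ind (dec-true (j ≟ j) refl)

unit-≢ : ∀ {p} {j k : Fin p} → j ≢ k → unit j k ≡ 0
unit-≢ {j = j} {k} j≢k = cong ind (dec-false (j ≟ k) j≢k)

lin-unit : ∀ {p} (j : Fin p) α i → lin (unit j) α i ≡ α j i
lin-unit zero    α i = trans (cong₂ ℤ._+_ (ℤ.*-identityˡ (α zero i)) (lin-0 (α ∘ suc) i)) (ℤ.+-identityʳ (α zero i))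
lin-unit (suc j) α i = trans (ℤ.+-identityˡ _) (lin-unit j (α ∘ suc) i)

sum-unit : ∀ {p} (j : Fin p) → sum (unit j) ≡ 1
sum-unit {suc p} zero    = cong suc (sum-≡0 {p} (λ _ → refl))
sum-unit {suc p} (suc j) = sum-unit j

lin-congʳ : ∀ {p} (z : Fin p → ℕ) (α β : Fin p → ℕ → ℤ) {i} → (∀ j → α j i ≡ β j i) → lin z α i ≡ lin z β i
lin-congʳ z α β α≡β = ℤΣ.sum-cong-≗ (λ j → cong (+ z j ℤ.*_) (α≡β j))

count : ∀ {q p} → (Fin q → Fin p) → Fin p → ℕ
count e j = sum (λ c → unit (e c) j)

-- Models picking z j columns from each class j of `e`, through its effect on sums. The field `all`
-- says that a class in full demand is taken entirely; it secures the distinguished column.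
record Choice {q p} (e : Fin q → Fin p) (z : Fin p → ℕ) : Set where
  field
    chosen : Fin q → Bool
    lin≡   : ∀ α i → lin (ind ∘ chosen) (α ∘ e) i ≡ lin z α i
    sum≡   : sum (ind ∘ chosen) ≡ sum z
    all    : ∀ c → z (e c) ≡ count e (e c) → chosen c ≡ true

-- Greedy: the first column is taken exactly when its class still has demand, which then drops by
-- one.
choose : ∀ {q p} (e : Fin q → Fin p) (z : Fin p → ℕ) → (∀ j → z j ≤ count e j) → Choice e z
choose {zero} {p} e z z≤ = record
  { chosen = λ ()
  ; lin≡   = λ α i → sym (trans (lin-cong (λ j → n≤0⇒n≡0 (z≤ j)) α i) (lin-0 α i))
  ; sum≡   = sym (sum-≡0 (n≤0⇒n≡0 ∘ z≤))
  ; all    = λ ()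
  }
choose {suc q} {p} e z z≤ with z (e zero) in z₀≡
... | zero = record
  { chosen = λ { zero → false ; (suc c) → chosen c }
  ; lin≡   = λ α i → trans (ℤ.+-identityˡ _) (lin≡ α i)
  ; sum≡   = sum≡
  ; all    = λ where
      zero    eq → contradiction (trans (sym z₀≡) (trans eq (cong (_+ count (e ∘ suc) (e zero)) (unit-refl (e zero))))) λ()
      (suc c) eq → all c (trans eq (cong (_+ count (e ∘ suc) (e (suc c))) (unit-≢ (e₀≢ c eq))))
  }
  where
  e₀≢ : ∀ c → z (e (suc c)) ≡ count e (e (suc c)) → e zero ≢ e (suc c)
  e₀≢ c eq e₀≡ = contradiction (begin
    0                                   ≡⟨ z₀≡ ⟨
    z (e zero)                          ≡⟨ cong z e₀≡ ⟩
    z (e (suc c))                       ≡⟨ eq ⟩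
    count e (e (suc c))                 ≡⟨ cong (count e) e₀≡ ⟨
    unit (e zero) (e zero) + _          ≡⟨ cong (_+ count (e ∘ suc) (e zero)) (unit-refl (e zero)) ⟩
    suc (count (e ∘ suc) (e zero))      ∎) λ()
    where open ≡-Reasoning
  z≤′ : ∀ j → z j ≤ count (e ∘ suc) j
  z≤′ j with e zero ≟ j
  ... | yes refl = ≤-trans (≤-reflexive z₀≡) z≤n
  ... | no e₀≢j  = subst (λ u → z j ≤ u + count (e ∘ suc) j) (unit-≢ e₀≢j) (z≤ j)
  open Choice (choose (e ∘ suc) z z≤′)
... | suc m = record
  { chosen = λ { zero → true ; (suc c) → chosen c }
  ; lin≡   = λ α i → begin
      (+ 1) ℤ.* α (e zero) i ℤ.+ lin (ind ∘ chosen) (α ∘ e ∘ suc) i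
        ≡⟨ cong₂ ℤ._+_ (ℤ.*-identityˡ (α (e zero) i)) (lin≡ α i) ⟩
      α (e zero) i ℤ.+ lin z′ α i                                 ≡⟨ cong (ℤ._+ lin z′ α i) (lin-unit (e zero) α i) ⟨
      lin (unit (e zero)) α i ℤ.+ lin z′ α i                      ≡⟨ lin-+ (unit (e zero)) z′ α i ⟨
      lin (λ j → unit (e zero) j + z′ j) α i                      ≡⟨ lin-cong split α i ⟩
      lin z α i                                                   ∎
  ; sum≡   = begin
      1 + sum (ind ∘ chosen)                 ≡⟨ cong₂ _+_ (sym (sum-unit (e zero))) sum≡ ⟩
      sum (unit (e zero)) + sum z′           ≡⟨ ∑-distrib-+ (unit (e zero)) z′ ⟨
      sum (λ j → unit (e zero) j + z′ j)     ≡⟨ sum-cong-≗ split ⟩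
      sum z                                  ∎
  ; all    = λ where
      zero    eq → refl
      (suc c) eq → all c (trans (cong (_∸ unit (e zero) (e (suc c))) eq) (m+n∸m≡n (unit (e zero) (e (suc c))) _))
  }
  where
  open ≡-Reasoning
  z′ : Fin p → ℕ
  z′ j = z j ∸ unit (e zero) j
  split : ∀ j → unit (e zero) j + z′ j ≡ z j
  split j with e zero ≟ j
  ... | yes refl = trans (cong (λ a → 1 + (a ∸ 1)) z₀≡) (sym z₀≡)
  ... | no _     = refl
  open Choice (choose (e ∘ suc) z′ λ j → m≤n+o⇒m∸n≤o (z j) (unit (e zero) j) (z≤ j))

module _ (n : ℕ) .{{_ : NonZero n}} {q} (a : Fin q → ℕ → ℤ) (light : ∀ c → weight n (a c) ≤ 3 * n) where

  representatives : ∀ {m} (g : Fin q → Fin m) → (∀ c d → g c ≡ g d → ∀ {i} → i < n → a c i ≡ a d i) →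
                    ∃ λ α → (∀ j → weight n (α j) ≤ 3 * n) × (∀ c {i} → i < n → α (g c) i ≡ a c i)
  representatives {m} g g-inj = α , α-light , α-eq
    where
    α : Fin m → ℕ → ℤ
    α j with any? (λ c → g c ≟ j)
    ... | yes (c , _) = a c
    -- A class without columns gets the zero vector, so that it is light as well.
    ... | no _        = λ _ → 0ℤ
    α-light : ∀ j → weight n (α j) ≤ 3 * n
    α-light j with any? (λ c → g c ≟ j)
    ... | yes (c , _) = light c
    ... | no _        = ≤-trans (≤-reflexive (sumTo-zero n (*-zeroʳ ∘ suc))) z≤n
    α-eq : ∀ c {i} → i < n → α (g c) i ≡ a c i
    α-eq c i<n with any? (λ d → g d ≟ g c)
    ... | yes (d , gd≡gc) = g-inj d c gd≡gc i<n
    ... | no ∄            = contradiction (c , refl) ∄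

  -- The distinguished column c₀ gets class zero to itself; the other columns
  -- are classified by their values.
  balanced-subfamily :
    (∀ {i} → i < n → lin (const 1) a i ≡ 0ℤ) → ∀ c₀ →
    ∃ λ Z → Z c₀ ≡ true × (∀ {i} → i < n → lin (ind ∘ Z) a i ≡ 0ℤ) × sum (ind ∘ Z) ≤ 2 ^ (41 * n)
  balanced-subfamily total c₀ =
    let g , g-inj = classes
        β , β-light , β-eq = representatives g g-inj
    in with-classes g β β-light β-eq
    where
    M = 2 ^ (13 * n)
    classes : Σ[ g ∈ (Fin q → Fin M) ] (∀ c d → g c ≡ g d → ∀ {i} → i < n → a c i ≡ a d i)
    classes = (λ c → code n (a c) (light′ c)) , λ c d → code-injective n {a c} {a d} (light′ c) (light′ d)
      where
      light′ : ∀ c → weight n (a c) ≤ 48 * n * n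
      light′ c = ≤-trans (light c) (*-monoˡ-≤ n (≤-trans (m≤m+n 3 45) (m≤m*n 48 n)))
    with-classes : ∀ (g : Fin q → Fin M) (β : Fin M → ℕ → ℤ) → (∀ j → weight n (β j) ≤ 3 * n) →
      (∀ c {i} → i < n → β (g c) i ≡ a c i) →
      ∃ λ Z → Z c₀ ≡ true × (∀ {i} → i < n → lin (ind ∘ Z) a i ≡ 0ℤ) × sum (ind ∘ Z) ≤ 2 ^ (41 * n)
    with-classes g β β-light β-eq =
      let y , By , 0<y₀ , y≤ , y-small =
            small-balanced-below n α α-light (sum (count e)) (count e) ≤-refl balanced-count (e c₀) count₀>0
          open Choice (choose e y y≤)
      in chosen
         -- The class of `c₀` has no other member, so a positive entry of `y` there already exhausts
         -- it.
         , all c₀ (≤-antisym (y≤ (e c₀)) (≤-trans count₀≤1 0<y₀))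
         , (λ {i} i<n → trans (lin-congʳ (ind ∘ chosen) a (α ∘ e) (λ c → sym (α-eq c i<n))) (trans (lin≡ α i) (By i<n)))
         , ≤-trans (≤-reflexive sum≡) (≤-trans (sum-const-≤ y-small) bound)
      where
      e : Fin q → Fin (suc M)
      e c with c ≟ c₀
      ... | yes _ = zero
      ... | no _  = suc (g c)
      α : Fin (suc M) → ℕ → ℤ
      α zero    = a c₀
      α (suc j) = β j
      α-light : ∀ j → weight n (α j) ≤ 3 * n
      α-light zero    = light c₀
      α-light (suc j) = β-light j
      α-eq : ∀ c {i} → i < n → α (e c) i ≡ a c i
      α-eq c i<n with c ≟ c₀
      ... | yes refl = refl
      ... | no _     = β-eq c i<n
      -- For the demand `count e` every column is chosen, so `lin≡` turns the sum over classes into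
      -- the sum over all columns.
      balanced-count : ∀ {i} → i < n → lin (count e) α i ≡ 0ℤ
      balanced-count {i} i<n = begin
        lin (count e) α i                 ≡⟨ lin≡ α i ⟨
        lin (ind ∘ chosen) (α ∘ e) i      ≡⟨ lin-cong (λ c → cong ind (all c refl)) (α ∘ e) i ⟩
        lin (const 1) (α ∘ e) i           ≡⟨ lin-congʳ (const 1) (α ∘ e) a (λ c → α-eq c i<n) ⟩
        lin (const 1) a i                 ≡⟨ total i<n ⟩
        0ℤ                                ∎
        where
        open ≡-Reasoning
        open Choice (choose e (count e) (λ _ → ≤-refl))
      count₀>0 : 0 < count e (e c₀)
      count₀>0 = ≤-trans (≤-reflexive (sym (unit-refl (e c₀)))) (term≤sum (λ c → unit (e c) (e c₀)) c₀)
      e-c₀ : e c₀ ≡ zero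
      e-c₀ with c₀ ≟ c₀
      ... | yes _  = refl
      ... | no c≢c = contradiction refl c≢c
      unit-e≤ : ∀ c → unit (e c) zero ≤ unit c₀ c
      unit-e≤ c with c ≟ c₀
      ... | yes refl = ≤-reflexive (sym (unit-refl c₀))
      ... | no _     = z≤n
      count₀≤1 : count e (e c₀) ≤ 1
      count₀≤1 = subst (λ j → count e j ≤ 1) (sym e-c₀)
                   (≤-trans (sum-mono-≤ unit-e≤) (≤-reflexive (sum-unit c₀)))
      -- There are `suc M` classes, each with an entry of at most `suc M * M`.
      bound : suc M * (suc M * M) ≤ 2 ^ (41 * n)
      bound = begin
        suc M * (suc M * M)                       ≤⟨ *-mono-≤ 1+M≤2M (*-monoˡ-≤ M 1+M≤2M) ⟩
        2 ^ (1 + 13 * n) * (2 ^ (1 + 13 * n) * M)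
          ≡⟨ cong (2 ^ (1 + 13 * n) *_) (^-distribˡ-+-* 2 (1 + 13 * n) (13 * n)) ⟨
        2 ^ (1 + 13 * n) * 2 ^ (1 + 13 * n + 13 * n) ≡⟨ ^-distribˡ-+-* 2 (1 + 13 * n) (1 + 13 * n + 13 * n) ⟨
        2 ^ (1 + 13 * n + (1 + 13 * n + 13 * n))  ≤⟨ ^-monoʳ-≤ 2 exponent ⟩
        2 ^ (41 * n)                              ∎
        where
        open ≤-Reasoning
        1+M≤2M : suc M ≤ 2 * M
        1+M≤2M = +-mono-≤ (m^n>0 2 (13 * n)) (≤-reflexive (sym (+-identityʳ M)))
        regroup : ∀ x → 1 + 13 * x + (1 + 13 * x + 13 * x) ≡ 2 + 39 * x
        regroup = solve-∀
        exponent : 1 + 13 * n + (1 + 13 * n + 13 * n) ≤ 41 * n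
        exponent = begin
          1 + 13 * n + (1 + 13 * n + 13 * n)   ≡⟨ regroup n ⟩
          2 + 39 * n                           ≤⟨ +-monoˡ-≤ (39 * n) (m≤m*n 2 n) ⟩
          2 * n + 39 * n                       ≡⟨ *-distribʳ-+ n 2 39 ⟨
          41 * n                               ∎

-- Permutations between functions with the same fibres

eq : ℕ → ℕ → ℕ
eq a b = ind (a ≡ᵇ b)

eq-refl : ∀ a → eq a a ≡ 1
eq-refl zero    = refl
eq-refl (suc a) = eq-refl a

eq-pos : ∀ a b → 0 < eq a b → a ≡ b
eq-pos zero    zero    _   = refl
eq-pos (suc a) (suc b) pos = cong suc (eq-pos a b pos)

eq-≢ : ∀ {a b} → a ≢ b → eq a b ≡ 0
eq-≢ {a} {b} a≢b = n≤0⇒n≡0 (≮⇒≥ (a≢b ∘ eq-pos a b))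

sumTo-eq : ∀ n {b} (w : ℕ → ℕ) → b < n → sumTo n (λ i → w i * eq b i) ≡ w b
sumTo-eq (suc n) {b} w b<1+n with m≤n⇒m<n∨m≡n (s≤s⁻¹ b<1+n)
... | inj₁ b<n  = trans (cong₂ _+_ (sumTo-eq n w b<n) (trans (cong (w n *_) (eq-≢ (<⇒≢ b<n))) (*-zeroʳ (w n)))) (+-identityʳ (w b))
... | inj₂ refl = cong₂ _+_
  (trans (sumTo-cong n (λ {i} i<n → trans (cong (w i *_) (eq-≢ (≢-sym (<⇒≢ i<n)))) (*-zeroʳ (w i)))) (sumTo-zero n (λ _ → refl)))
  (trans (cong (w b *_) (eq-refl b)) (*-identityʳ (w b)))

positive-term : ∀ {p} (t : Fin p → ℕ) → 0 < sum t → ∃ λ j → 0 < t j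
positive-term {suc p} t pos with t zero in t₀≡
... | suc _ = zero , subst (0 <_) (sym t₀≡) z<s
... | zero  = let j , 0<tj = positive-term (t ∘ suc) pos in suc j , 0<tj

fibre : ∀ {p} → (Fin p → ℕ) → ℕ → ℕ
fibre α s = sum (λ r → eq (α r) s)

-- Equal fibres give a `j` at which `β` takes the value `α zero`. Match zero with `j`; the fibres
-- still agree after both are removed.
same-fibres⇒permutation : ∀ {p} (α β : Fin p → ℕ) → (∀ s → fibre α s ≡ fibre β s) →
                          Σ[ π ∈ Permutation′ p ] (∀ r → α r ≡ β (π ⟨$⟩ʳ r))
same-fibres⇒permutation {zero}  α β same = Perm.id , λ ()
same-fibres⇒permutation {suc p} α β same =
  let j , pos = positive-term (λ r → eq (β r) (α zero)) β-hits
      βj≡α₀ = eq-pos (β j) (α zero) pos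
      π , α≡βπ = same-fibres⇒permutation (α ∘ suc) (β ∘ punchIn j) (λ s → +-cancelˡ-≡ (eq (α zero) s) _ _ (begin
        fibre α s                                             ≡⟨ same s ⟩
        fibre β s                                             ≡⟨ sum-remove {i = j} (λ r → eq (β r) s) ⟩
        eq (β j) s + fibre (β ∘ punchIn j) s                  ≡⟨ cong (λ a → eq a s + fibre (β ∘ punchIn j) s) βj≡α₀ ⟩
        eq (α zero) s + fibre (β ∘ punchIn j) s               ∎))
  in insert zero j π , λ where
       zero    → sym βj≡α₀
       (suc r) → trans (α≡βπ r) (cong β (sym (insert-punchIn zero j π r)))
  where
  open ≡-Reasoning
  β-hits : 0 < fibre β (α zero)
  β-hits = subst (0 <_) (same (α zero)) (subst (λ a → 0 < a + fibre (α ∘ suc) (α zero)) (sym (eq-refl (α zero))) z<s)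

sumTo-sum : ∀ m {p} (t : ℕ → Fin p → ℕ) → sumTo m (λ i → sum (t i)) ≡ sum (λ r → sumTo m (λ i → t i r))
sumTo-sum zero {p} t = sym (sum-≡0 {p} (λ _ → refl))
sumTo-sum (suc m) t = trans (cong (_+ sum (t m)) (sumTo-sum m t)) (sym (∑-distrib-+ (λ r → sumTo m (λ i → t i r)) (t m)))

-- Profiles do not count the value 0. Its fibre is what the fibres of 1, ..., n leave over, and
-- larger values are not attained.
bounded-same-fibres : ∀ n {p} (α β : Fin p → ℕ) → (∀ r → α r ≤ n) → (∀ r → β r ≤ n) →
                      (∀ {i} → i < n → fibre α (suc i) ≡ fibre β (suc i)) → ∀ s → fibre α s ≡ fibre β s
bounded-same-fibres n {p} α β α≤ β≤ same = cases
  where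
  once : ∀ a → a ≤ n → eq a 0 + sumTo n (λ i → eq a (suc i)) ≡ 1
  once zero    _   = cong suc (sumTo-zero n (λ _ → refl))
  once (suc a) a<n = trans (sumTo-cong n (λ {i} _ → sym (*-identityˡ (eq a i)))) (sumTo-eq n (const 1) a<n)
  all-fibres : ∀ (γ : Fin p → ℕ) → (∀ r → γ r ≤ n) → fibre γ 0 + sumTo n (fibre γ ∘ suc) ≡ sum {p} (const 1)
  all-fibres γ γ≤ = begin
    fibre γ 0 + sumTo n (fibre γ ∘ suc)
      ≡⟨ cong (_+_ (fibre γ 0)) (sumTo-sum n (λ i r → eq (γ r) (suc i))) ⟩
    fibre γ 0 + sum (λ r → sumTo n (λ i → eq (γ r) (suc i)))
      ≡⟨ ∑-distrib-+ (λ r → eq (γ r) 0) (λ r → sumTo n (λ i → eq (γ r) (suc i))) ⟨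
    sum (λ r → eq (γ r) 0 + sumTo n (λ i → eq (γ r) (suc i)))              ≡⟨ sum-cong-≗ (λ r → once (γ r) (γ≤ r)) ⟩
    sum {p} (const 1)                                                      ∎
    where open ≡-Reasoning
  empty : ∀ (γ : Fin p → ℕ) → (∀ r → γ r ≤ n) → ∀ {s} → n < s → fibre γ s ≡ 0
  empty γ γ≤ {s} n<s = sum-≡0 (λ r → eq-≢ (<⇒≢ (≤-<-trans (γ≤ r) n<s)))
  cases : ∀ s → fibre α s ≡ fibre β s
  cases zero = +-cancelʳ-≡ (sumTo n (fibre α ∘ suc)) _ _
    (trans (all-fibres α α≤) (trans (sym (all-fibres β β≤)) (cong (_+_ (fibre β 0)) (sym (sumTo-cong n same)))))
  cases (suc i) with i <? n
  ... | yes i<n = same i<n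
  ... | no i≮n  = trans (empty α α≤ (s≤s (≮⇒≥ i≮n))) (sym (empty β β≤ (s≤s (≮⇒≥ i≮n))))

∣tabulate∣ : ∀ {p} (b : Fin p → Bool) → ∣ tabulate b ∣ ≡ sum (ind ∘ b)
∣tabulate∣ {zero}  b = refl
∣tabulate∣ {suc p} b with b zero
... | true  = cong suc (∣tabulate∣ (b ∘ suc))
... | false = ∣tabulate∣ (b ∘ suc)

sum-unit-* : ∀ {p} (j : Fin p) (φ : Fin p → ℕ) → sum (λ r → unit j r * φ r) ≡ φ j
sum-unit-* {suc p} zero    φ = begin
  φ zero + 0 + sum {p} (const 0)   ≡⟨ cong (_+_ (φ zero + 0)) (sum-≡0 {p} (λ _ → refl)) ⟩
  φ zero + 0 + 0                   ≡⟨ trans (+-identityʳ _) (+-identityʳ _) ⟩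
  φ zero                           ∎
  where
  open ≡-Reasoning
sum-unit-* {suc p} (suc j) φ = sum-unit-* j (φ ∘ suc)

signed : ∀ {p} → (Fin p → ℕ → ℕ) → (Fin p → ℕ → ℕ) → Fin (p + p) → ℕ → ℤ
signed {p} X Y c i = [ (λ d → + X d i) , (λ d → ℤ.- (+ Y d i)) ] (splitAt p c)

lin-++ : ∀ m {n} (z : Fin (m + n) → ℕ) α i →
         lin z α i ≡ lin (z ∘ (_↑ˡ n)) (α ∘ (_↑ˡ n)) i ℤ.+ lin (z ∘ (m ↑ʳ_)) (α ∘ (m ↑ʳ_)) i
lin-++ zero    z α i = sym (ℤ.+-identityˡ _)
lin-++ (suc m) z α i = trans (cong (ℤ._+_ (+ z zero ℤ.* α zero i)) (lin-++ m (z ∘ suc) (α ∘ suc) i))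
                             (sym (ℤ.+-assoc (+ z zero ℤ.* α zero i) _ _))

sum-↑ˡ≤ : ∀ m {n} (t : Fin (m + n) → ℕ) → sum (t ∘ (_↑ˡ n)) ≤ sum t
sum-↑ˡ≤ zero    t = z≤n
sum-↑ˡ≤ (suc m) t = +-monoʳ-≤ (t zero) (sum-↑ˡ≤ m (t ∘ suc))

lin-pos : ∀ {p} (z : Fin p → ℕ) (X : Fin p → ℕ → ℕ) i → lin z (λ c i → + X c i) i ≡ + sum (λ c → z c * X c i)
lin-pos {zero}  z X i = refl
lin-pos {suc p} z X i = trans (cong₂ ℤ._+_ (sym (ℤ.pos-* (z zero) (X zero i))) (lin-pos (z ∘ suc) (X ∘ suc) i))
                              (sym (ℤ.pos-+ (z zero * X zero i) _))

lin-neg : ∀ {p} (z : Fin p → ℕ) α i → lin z (λ c i → ℤ.- α c i) i ≡ ℤ.- lin z α i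
lin-neg {zero}  z α i = refl
lin-neg {suc p} z α i = trans (cong₂ ℤ._+_ (sym (ℤ.neg-distribʳ-* (+ z zero) (α zero i))) (lin-neg (z ∘ suc) (α ∘ suc) i))
                              (sym (ℤ.neg-distrib-+ (+ z zero ℤ.* α zero i) _))

lin-signed : ∀ {p} (z : Fin (p + p) → ℕ) (X Y : Fin p → ℕ → ℕ) i → lin z (signed X Y) i ≡
             + sum (λ c → z (c ↑ˡ p) * X c i) ℤ.- + sum (λ c → z (p ↑ʳ c) * Y c i)
lin-signed {p} z X Y i = begin
  lin z (signed X Y) i
    ≡⟨ lin-++ p z (signed X Y) i ⟩
  lin (z ∘ (_↑ˡ p)) (signed X Y ∘ (_↑ˡ p)) i ℤ.+ lin (z ∘ (p ↑ʳ_)) (signed X Y ∘ (p ↑ʳ_)) i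
    ≡⟨ cong₂ ℤ._+_
         (lin-congʳ (z ∘ (_↑ˡ p)) (signed X Y ∘ (_↑ˡ p)) (λ c i → + X c i)
           (λ c → cong [ (λ d → + X d i) , (λ d → ℤ.- (+ Y d i)) ] (splitAt-↑ˡ p c p)))
         (lin-congʳ (z ∘ (p ↑ʳ_)) (signed X Y ∘ (p ↑ʳ_)) (λ c i → ℤ.- (+ Y c i))
           (λ c → cong [ (λ d → + X d i) , (λ d → ℤ.- (+ Y d i)) ] (splitAt-↑ʳ p p c))) ⟩
  lin (z ∘ (_↑ˡ p)) (λ c i → + X c i) i ℤ.+ lin (z ∘ (p ↑ʳ_)) (λ c i → ℤ.- (+ Y c i)) i
    ≡⟨ cong₂ ℤ._+_ (lin-pos (z ∘ (_↑ˡ p)) X i)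
         (trans (lin-neg (z ∘ (p ↑ʳ_)) (λ c i → + Y c i) i) (cong ℤ.-_ (lin-pos (z ∘ (p ↑ʳ_)) Y i))) ⟩
  + sum (λ c → z (c ↑ˡ p) * X c i) ℤ.- + sum (λ c → z (p ↑ʳ c) * Y c i)
    ∎
  where open ≡-Reasoning

balanced-subfamilies :
  ∀ n .{{_ : NonZero n}} {p} (X Y : Fin p → ℕ → ℕ) →
  (∀ c → sumTo n (λ i → suc i * X c i) ≤ 3 * n) → (∀ c → sumTo n (λ i → suc i * Y c i) ≤ 3 * n) →
  (∀ {i} → i < n → sum (λ c → X c i) ≡ sum (λ c → Y c i)) → ∀ c₀ →
  ∃₂ λ (A B : Fin p → Bool) → A c₀ ≡ true × sum (ind ∘ A) ≤ 2 ^ (41 * n) ×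
  (∀ {i} → i < n → sum (λ c → ind (A c) * X c i) ≡ sum (λ c → ind (B c) * Y c i))
balanced-subfamilies n {p} X Y X-light Y-light same c₀ =
  let Z , Zc₀ , balanced , sum≤ = balanced-subfamily n (signed X Y) light total (c₀ ↑ˡ p)
  in Z ∘ (_↑ˡ p) , Z ∘ (p ↑ʳ_) , Zc₀ , ≤-trans (sum-↑ˡ≤ p (ind ∘ Z)) sum≤
     , λ {i} i<n → ℤ.+-injective (ℤ.i-j≡0⇒i≡j
         (+ sum (λ c → ind (Z (c ↑ˡ p)) * X c i)) (+ sum (λ c → ind (Z (p ↑ʳ c)) * Y c i))
         (trans (sym (lin-signed (ind ∘ Z) X Y i)) (balanced i<n)))
  where
  light : ∀ c → weight n (signed X Y c) ≤ 3 * n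
  light c with splitAt p c
  ... | inj₁ d = X-light d
  ... | inj₂ d = ≤-trans (≤-reflexive (sumTo-cong n (λ {i} _ → cong (suc i *_) (ℤ.∣-i∣≡∣i∣ (+ Y d i))))) (Y-light d)
  total : ∀ {i} → i < n → lin (const 1) (signed X Y) i ≡ 0ℤ
  total {i} i<n = begin
    lin (const 1) (signed X Y) i                                      ≡⟨ lin-signed (const 1) X Y i ⟩
    + sum (λ c → 1 * X c i) ℤ.- + sum (λ c → 1 * Y c i)
      ≡⟨ cong₂ (λ a b → + a ℤ.- + b) (sum-cong-≗ (λ c → *-identityˡ (X c i))) (sum-cong-≗ (λ c → *-identityˡ (Y c i))) ⟩
    + sum (λ c → X c i) ℤ.- + sum (λ c → Y c i)
      ≡⟨ cong (λ a → + a ℤ.- + sum (λ c → Y c i)) (same i<n) ⟩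
    + sum (λ c → Y c i) ℤ.- + sum (λ c → Y c i)                       ≡⟨ ℤ.+-inverseʳ (+ sum (λ c → Y c i)) ⟩
    0ℤ                                                                ∎
    where open ≡-Reasoning

-- Remapping events

ind-injective : ∀ {a b} → ind a ≡ ind b → a ≡ b
ind-injective {false} {false} _ = refl
ind-injective {true}  {true}  _ = refl

sum-ind-permutation : ∀ {p} (A B : Fin p → Bool) → sum (ind ∘ A) ≡ sum (ind ∘ B) →
                      Σ[ π ∈ Permutation′ p ] (∀ c → A c ≡ B (π ⟨$⟩ʳ c))
sum-ind-permutation A B same =
  let π , eqs = same-fibres⇒permutation (ind ∘ A) (ind ∘ B)
                  (bounded-same-fibres 1 (ind ∘ A) (ind ∘ B) (λ c → ind≤1 (A c)) (λ c → ind≤1 (B c)) fibre₁)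
  in π , λ c → ind-injective (eqs c)
  where
  ind≤1 : ∀ b → ind b ≤ 1
  ind≤1 false = z≤n
  ind≤1 true  = ≤-refl
  eq-ind : ∀ b → eq (ind b) 1 ≡ ind b
  eq-ind false = refl
  eq-ind true  = refl
  fibre₁ : ∀ {i} → i < 1 → fibre (ind ∘ A) (suc i) ≡ fibre (ind ∘ B) (suc i)
  fibre₁ z<s = trans (sum-cong-≗ (eq-ind ∘ A)) (trans same (sym (sum-cong-≗ (eq-ind ∘ B))))

-- Double counting: each `r` is met only at the index F r.
sum-fibres : ∀ {p q} (F : Fin p → Fin q) (φ : Fin p → ℕ) (χ : Fin q → ℕ) →
             sum (λ c → χ c * sum (λ r → unit (F r) c * φ r)) ≡ sum (λ r → χ (F r) * φ r)
sum-fibres F φ χ = begin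
  sum (λ c → χ c * sum (λ r → unit (F r) c * φ r))
    ≡⟨ sum-cong-≗ (λ c → *-distribˡ-sum (χ c) (λ r → unit (F r) c * φ r)) ⟩
  sum (λ c → sum (λ r → χ c * (unit (F r) c * φ r)))   ≡⟨ ∑-comm (λ c r → χ c * (unit (F r) c * φ r)) ⟩
  sum (λ r → sum (λ c → χ c * (unit (F r) c * φ r)))
    ≡⟨ sum-cong-≗ (λ r → sum-cong-≗ (λ c → x∙yz≈y∙xz (χ c) (unit (F r) c) (φ r))) ⟩
  sum (λ r → sum (λ c → unit (F r) c * (χ c * φ r)))   ≡⟨ sum-cong-≗ (λ r → sum-unit-* (F r) (λ c → χ c * φ r)) ⟩
  sum (λ r → χ (F r) * φ r)                            ∎
  where
  open ≡-Reasoning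

module _ (ℓ k : ℕ) where
  open Repartitioning ℓ k

  merge-cong : ∀ R u v {x y} → R x ≡ R y → merge R u v x ≡ merge R u v y
  merge-cong R u v {x} {y} Rx≡Ry with R x ≟ R v | R y ≟ R v
  ... | yes _     | yes _     = refl
  ... | yes Rx≡Rv | no Ry≢Rv  = contradiction (trans (sym Rx≡Ry) Rx≡Rv) Ry≢Rv
  ... | no Rx≢Rv  | yes Ry≡Rv = contradiction (trans Rx≡Ry Ry≡Rv) Rx≢Rv
  ... | no _      | no _      = Rx≡Ry

  merge-joins : ∀ R u v → merge R u v u ≡ merge R u v v
  merge-joins R u v with R u ≟ R v | R v ≟ R v
  ... | _     | no Rv≢Rv = contradiction refl Rv≢Rv
  ... | yes _ | yes _    = refl
  ... | no _  | yes _    = refl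

  merge-invariant : ∀ R u v (g : Mapping) → Invariant R g → g u ≡ g v → Invariant (merge R u v) g
  merge-invariant R u v g inv gu≡gv {x} {y} eq with R x ≟ R v | R y ≟ R v
  ... | yes Rx≡Rv | yes Ry≡Rv = inv (trans Rx≡Rv (sym Ry≡Rv))
  ... | yes Rx≡Rv | no _      = trans (inv Rx≡Rv) (trans (sym gu≡gv) (inv eq))
  ... | no _      | yes Ry≡Rv = trans (inv eq) (trans gu≡gv (inv (sym Ry≡Rv)))
  ... | no _      | no _      = inv eq

  -- Labels then belong to the components they name, so under the invariant a mapping can be
  -- evaluated at the label instead of the node. Singletons have this property and merging preserves
  -- it.
  Idempotent : Partition → Set
  Idempotent R = ∀ x → R (R x) ≡ R x

  merge-idempotent : ∀ R u v → ¬ SameComponent R u v → Idempotent R → Idempotent (merge R u v)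
  merge-idempotent R u v u≁v idem x with R x ≟ R v
  merge-idempotent R u v u≁v idem x | yes _ with R (R u) ≟ R v
  ... | yes RRu≡Rv = contradiction (trans (sym (idem u)) RRu≡Rv) u≁v
  ... | no _       = idem u
  merge-idempotent R u v u≁v idem x | no Rx≢Rv with R (R x) ≟ R v
  ... | yes RRx≡Rv = contradiction (trans (sym (idem x)) RRx≡Rv) Rx≢Rv
  ... | no _       = idem x

-- Construction of a cheap mapping at a remapping event

module Remapping (ℓ k : ℕ) .{{k≢0 : NonZero k}}
  (R : Repartitioning.Partition ℓ k) (f h : Repartitioning.Mapping ℓ k) (u v : Repartitioning.Node ℓ k)
  (idempotent : Idempotent ℓ k R) (u≁v : ¬ Repartitioning.SameComponent ℓ k R u v)
  (f-feasible : Repartitioning.Feasible ℓ k R f)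
  (h-feasible : Repartitioning.Feasible ℓ k (Repartitioning.merge ℓ k R u v) h) where
  open Repartitioning ℓ k

  n : ℕ
  n = suc (suc k)

  -- Zero at a node that labels no component, so that a sum over all nodes weighted by `size` runs
  -- over components.
  size : Node → ℕ
  size r = sum (λ x → unit (R x) r)

  sum-size : ∀ φ → sum (λ r → size r * φ r) ≡ sum (φ ∘ R)
  sum-size φ = begin
    sum (λ r → size r * φ r)                     ≡⟨ sum-cong-≗ (λ r → *-distribʳ-sum (φ r) (λ x → unit (R x) r)) ⟩
    sum (λ r → sum (λ x → unit (R x) r * φ r))   ≡⟨ ∑-comm (λ r x → unit (R x) r * φ r) ⟩
    sum (λ x → sum (λ r → unit (R x) r * φ r))   ≡⟨ sum-cong-≗ (λ x → sum-unit-* (R x) φ) ⟩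
    sum (φ ∘ R)                                  ∎
    where open ≡-Reasoning

  size-R>0 : ∀ x → 0 < size (R x)
  size-R>0 x = ≤-trans (≤-reflexive (sym (unit-refl (R x)))) (term≤sum (λ y → unit (R y) (R x)) x)

  load : ∀ (g : Mapping) → Valid g → Invariant R g → ∀ c → sum (λ r → size r * unit (g r) c) ≡ k
  load g valid inv c = begin
    sum (λ r → size r * unit (g r) c)  ≡⟨ sum-size (λ r → unit (g r) c) ⟩
    sum (λ x → unit (g (R x)) c)       ≡⟨ sum-cong-≗ (λ x → cong (λ d → unit d c) (inv (idempotent x))) ⟩
    sum (λ x → unit (g x) c)           ≡⟨ ∣tabulate∣ (λ x → does (g x ≟ c)) ⟨
    ∣ nodesIn g c ∣                    ≡⟨ valid c ⟩
    k                                  ∎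
    where open ≡-Reasoning

  f-invariant : Invariant R f
  f-invariant = proj₂ f-feasible

  h-invariant : Invariant R h
  h-invariant = proj₂ h-feasible ∘ merge-cong ℓ k R u v

  f-load : ∀ c → sum (λ r → size r * unit (f r) c) ≡ k
  f-load = load f (proj₁ f-feasible) f-invariant

  h-load : ∀ c → sum (λ r → size r * unit (h r) c) ≡ k
  h-load = load h (proj₁ h-feasible) h-invariant

  size≤k : ∀ r → size r ≤ k
  size≤k r = begin
    size r                                 ≡⟨ *-identityʳ (size r) ⟨
    size r * 1                             ≡⟨ cong (size r *_) (unit-refl (f r)) ⟨
    size r * unit (f r) (f r)              ≤⟨ term≤sum (λ s → size s * unit (f s) (f r)) r ⟩
    sum (λ s → size s * unit (f s) (f r))  ≡⟨ f-load (f r) ⟩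
    k                                      ∎
    where open ≤-Reasoning

  -- The kind of a component is its size, except that the two components to be
  -- merged have kinds of their own; labels of no component have kind 0.
  kind : Node → ℕ
  kind r with r ≟ R u | r ≟ R v
  ... | yes _ | _     = suc k
  ... | no _  | yes _ = suc (suc k)
  ... | no _  | no _  = size r

  kind-u : kind (R u) ≡ suc k
  kind-u with R u ≟ R u
  ... | yes _    = refl
  ... | no Ru≢Ru = contradiction refl Ru≢Ru

  kind-v : kind (R v) ≡ suc (suc k)
  kind-v with R v ≟ R u | R v ≟ R v
  ... | yes Rv≡Ru | _        = contradiction (sym Rv≡Ru) u≁v
  ... | no _      | yes _    = refl
  ... | no _      | no Rv≢Rv = contradiction refl Rv≢Rv

  kind-u⁻¹ : ∀ {r} → kind r ≡ suc k → r ≡ R u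
  kind-u⁻¹ {r} eq with r ≟ R u | r ≟ R v
  ... | yes r≡Ru | _ = r≡Ru
  ... | no _ | yes _ = contradiction (sym eq) (<⇒≢ ≤-refl)
  ... | no _ | no _  = contradiction eq (<⇒≢ (s≤s (size≤k r)))

  kind-v⁻¹ : ∀ {r} → kind r ≡ suc (suc k) → r ≡ R v
  kind-v⁻¹ {r} eq with r ≟ R u | r ≟ R v
  ... | yes _ | _        = contradiction eq (<⇒≢ ≤-refl)
  ... | no _  | yes r≡Rv = r≡Rv
  ... | no _  | no _     = contradiction eq (<⇒≢ (s≤s (m≤n⇒m≤1+n (size≤k r))))

  kind-size : ∀ {r s} → kind r ≡ kind s → size r ≡ size s
  kind-size {r} {s} eq = sizes (kind-cases r) (kind-cases s)
    where
    Kind : Node → Set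
    Kind r = r ≡ R u ⊎ r ≡ R v ⊎ kind r ≡ size r
    kind-cases : ∀ r → Kind r
    kind-cases r with r ≟ R u | r ≟ R v
    ... | yes r≡Ru | _        = inj₁ r≡Ru
    ... | no _     | yes r≡Rv = inj₂ (inj₁ r≡Rv)
    ... | no _     | no _     = inj₂ (inj₂ refl)
    sizes : Kind r → Kind s → size r ≡ size s
    sizes (inj₁ refl)        _                  = cong size (sym (kind-u⁻¹ (trans (sym eq) kind-u)))
    sizes (inj₂ (inj₁ refl)) _                  = cong size (sym (kind-v⁻¹ (trans (sym eq) kind-v)))
    sizes _                  (inj₁ refl)        = cong size (kind-u⁻¹ (trans eq kind-u))
    sizes _                  (inj₂ (inj₁ refl)) = cong size (kind-v⁻¹ (trans eq kind-v))
    sizes (inj₂ (inj₂ r≡))   (inj₂ (inj₂ s≡))   = trans (sym r≡) (trans eq s≡)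

  kind≡0⇒size≡0 : ∀ {r} → kind r ≡ 0 → size r ≡ 0
  kind≡0⇒size≡0 {r} eq with r ≟ R u | r ≟ R v
  ... | no _ | no _ = eq

  kind≤n : ∀ r → kind r ≤ n
  kind≤n r with r ≟ R u | r ≟ R v
  ... | yes _ | _     = n≤1+n (suc k)
  ... | no _  | yes _ = ≤-refl
  ... | no _  | no _  = m≤n⇒m≤1+n (m≤n⇒m≤1+n (size≤k r))

  -- The two special kinds may exceed the sizes, but they add at most (k + 1) + (k + 2) to a profile
  -- whose sizes sum to k. This is the origin of the weight bound 3n.
  kind≤ : ∀ r → kind r ≤ size r + (unit (R u) r * suc k + unit (R v) r * n)
  kind≤ r with r ≟ R u | r ≟ R v
  ... | yes refl | _     = begin
    suc k                                                      ≡⟨ *-identityˡ (suc k) ⟨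
    1 * suc k                                                  ≡⟨ cong (_* suc k) (unit-refl (R u)) ⟨
    unit (R u) (R u) * suc k                                   ≤⟨ m≤m+n _ _ ⟩
    unit (R u) (R u) * suc k + unit (R v) (R u) * n            ≤⟨ m≤n+m _ (size (R u)) ⟩
    size (R u) + (unit (R u) (R u) * suc k + unit (R v) (R u) * n) ∎
    where open ≤-Reasoning
  ... | no _     | yes refl = begin
    n                                                          ≡⟨ *-identityˡ n ⟨
    1 * n                                                      ≡⟨ cong (_* n) (unit-refl (R v)) ⟨
    unit (R v) (R v) * n                                       ≤⟨ m≤n+m _ _ ⟩
    unit (R u) (R v) * suc k + unit (R v) (R v) * n            ≤⟨ m≤n+m _ (size (R v)) ⟩
    size (R v) + (unit (R u) (R v) * suc k + unit (R v) (R v) * n) ∎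
    where open ≤-Reasoning
  ... | no _     | no _     = m≤m+n (size r) _

  profile : Mapping → Cluster → ℕ → ℕ
  profile g c i = sum (λ r → unit (g r) c * eq (kind r) (suc i))

  profile-light : ∀ g → (∀ c → sum (λ r → size r * unit (g r) c) ≡ k) → ∀ c →
                  sumTo n (λ i → suc i * profile g c i) ≤ 3 * n
  profile-light g g-load c = begin
    sumTo n (λ i → suc i * profile g c i)
      ≡⟨ sumTo-cong n (λ {i} _ → *-distribˡ-sum (suc i) (λ r → unit (g r) c * eq (kind r) (suc i))) ⟩
    sumTo n (λ i → sum (λ r → suc i * (unit (g r) c * eq (kind r) (suc i))))
      ≡⟨ sumTo-sum n (λ i r → suc i * (unit (g r) c * eq (kind r) (suc i))) ⟩
    sum (λ r → sumTo n (λ i → suc i * (unit (g r) c * eq (kind r) (suc i))))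
      ≤⟨ sum-mono-≤ (λ r → per-component r) ⟩
    sum (λ r → size r * unit (g r) c + (unit (R u) r * suc k + unit (R v) r * n))
      ≡⟨ ∑-distrib-+ (λ r → size r * unit (g r) c) (λ r → unit (R u) r * suc k + unit (R v) r * n) ⟩
    sum (λ r → size r * unit (g r) c) + sum (λ r → unit (R u) r * suc k + unit (R v) r * n)
      ≡⟨ cong₂ _+_ (g-load c) (∑-distrib-+ (λ r → unit (R u) r * suc k) (λ r → unit (R v) r * n)) ⟩
    k + (sum (λ r → unit (R u) r * suc k) + sum (λ r → unit (R v) r * n))
      ≡⟨ cong (_+_ k) (cong₂ _+_ (sum-unit-* (R u) (const (suc k))) (sum-unit-* (R v) (const n))) ⟩
    k + (suc k + n)
      ≤⟨ +-mono-≤ (m≤n+m k 2) (+-mono-≤ (n≤1+n (suc k)) (m≤m+n n 0)) ⟩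
    3 * n
      ∎
    where
    open ≤-Reasoning
    weigh : ∀ a → a ≤ n → sumTo n (λ i → suc i * eq a (suc i)) ≤ a
    weigh zero    _   = ≤-reflexive (trans (sumTo-cong n (λ {i} _ → *-zeroʳ (suc i))) (sumTo-zero n (λ _ → refl)))
    weigh (suc a) a<n = ≤-reflexive (sumTo-eq n suc a<n)
    unit≤1 : ∀ d → unit d c ≤ 1
    unit≤1 d with does (d ≟ c)
    ... | true  = ≤-refl
    ... | false = z≤n
    per-component : ∀ r → sumTo n (λ i → suc i * (unit (g r) c * eq (kind r) (suc i))) ≤
                          size r * unit (g r) c + (unit (R u) r * suc k + unit (R v) r * n)
    per-component r = begin
      sumTo n (λ i → suc i * (unit (g r) c * eq (kind r) (suc i)))
        ≡⟨ sumTo-cong n (λ {i} _ → x∙yz≈y∙xz (suc i) (unit (g r) c) (eq (kind r) (suc i))) ⟩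
      sumTo n (λ i → unit (g r) c * (suc i * eq (kind r) (suc i)))
        ≡⟨ sumTo-* n (unit (g r) c) (λ i → suc i * eq (kind r) (suc i)) ⟩
      unit (g r) c * sumTo n (λ i → suc i * eq (kind r) (suc i))
        ≤⟨ *-monoʳ-≤ (unit (g r) c) (≤-trans (weigh (kind r) (kind≤n r)) (kind≤ r)) ⟩
      unit (g r) c * (size r + extra)                               ≡⟨ *-distribˡ-+ (unit (g r) c) (size r) extra ⟩
      unit (g r) c * size r + unit (g r) c * extra
        ≤⟨ +-mono-≤ (≤-reflexive (*-comm (unit (g r) c) (size r))) (*-monoˡ-≤ extra (unit≤1 (g r))) ⟩
      size r * unit (g r) c + 1 * extra
        ≡⟨ cong (_+_ (size r * unit (g r) c)) (*-identityˡ extra) ⟩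
      size r * unit (g r) c + extra                                 ∎
      where extra = unit (R u) r * suc k + unit (R v) r * n

  sum-profile : ∀ g i → sum (λ c → profile g c i) ≡ fibre kind (suc i)
  sum-profile g i = begin
    sum (λ c → profile g c i)                 ≡⟨ sum-cong-≗ (λ c → sym (*-identityˡ (profile g c i))) ⟩
    sum (λ c → 1 * profile g c i)             ≡⟨ sum-fibres g (λ r → eq (kind r) (suc i)) (const 1) ⟩
    sum (λ r → 1 * eq (kind r) (suc i))       ≡⟨ sum-cong-≗ (λ r → *-identityˡ (eq (kind r) (suc i))) ⟩
    fibre kind (suc i)                        ∎
    where open ≡-Reasoning

  -- Refilling the clusters of `A` with the contents under `h` of the clusters of `B`

  module Rearranged (A B : Cluster → Bool) (Afu : A (f u) ≡ true)
    (same-profile : ∀ {i} → i < n → sum (λ c → ind (A c) * profile f c i) ≡ sum (λ c → ind (B c) * profile h c i)) where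

    -- The value 0, shared with empty labels, absorbs everything outside `S`. A single permutation
    -- of all nodes can then match the components in `A` with those in `B`.
    kindWithin : (Cluster → Bool) → Mapping → Node → ℕ
    kindWithin S g r = if S (g r) then kind r else 0

    kindWithin≤n : ∀ S g r → kindWithin S g r ≤ n
    kindWithin≤n S g r with S (g r)
    ... | true  = kind≤n r
    ... | false = z≤n

    fibre-kindWithin : ∀ S g i → fibre (kindWithin S g) (suc i) ≡ sum (λ c → ind (S c) * profile g c i)
    fibre-kindWithin S g i = trans (sum-cong-≗ pointwise) (sym (sum-fibres g (λ r → eq (kind r) (suc i)) (ind ∘ S)))
      where
      pointwise : ∀ r → eq (kindWithin S g r) (suc i) ≡ ind (S (g r)) * eq (kind r) (suc i)
      pointwise r with S (g r)
      ... | true  = sym (*-identityˡ (eq (kind r) (suc i)))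
      ... | false = refl

    abstract
      components : Σ[ φ ∈ Permutation′ (ℓ * k) ] (∀ r → kindWithin A f r ≡ kindWithin B h (φ ⟨$⟩ʳ r))
      components = same-fibres⇒permutation (kindWithin A f) (kindWithin B h)
        (bounded-same-fibres n (kindWithin A f) (kindWithin B h) (kindWithin≤n A f) (kindWithin≤n B h)
          (λ {i} i<n → trans (fibre-kindWithin A f i) (trans (same-profile i<n) (sym (fibre-kindWithin B h i)))))

    φ : Node → Node
    φ = proj₁ components ⟨$⟩ʳ_

    kind-φ : ∀ r → kindWithin A f r ≡ kindWithin B h (φ r)
    kind-φ = proj₂ components

    -- The matching may pair a node inside one family with a node outside the other, but only if the
    -- former labels no component and so has size zero.
    mass : ∀ r s → kindWithin A f r ≡ kindWithin B h s → size r * ind (A (f r)) ≡ size s * ind (B (h s))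
    mass r s eq with A (f r) | B (h s)
    ... | true  | true  = cong (_* 1) (kind-size eq)
    ... | true  | false = trans (cong (_* 1) (kind≡0⇒size≡0 eq)) (sym (*-zeroʳ (size s)))
    ... | false | true  = trans (*-zeroʳ (size r)) (sym (cong (_* 1) (kind≡0⇒size≡0 (sym eq))))
    ... | false | false = trans (*-zeroʳ (size r)) (sym (*-zeroʳ (size s)))

    total-mass : ∀ (S : Cluster → Bool) (g : Mapping) → (∀ c → sum (λ r → size r * unit (g r) c) ≡ k) →
                 sum (λ r → size r * ind (S (g r))) ≡ sum (ind ∘ S) * k
    total-mass S g g-load = begin
      sum (λ r → size r * ind (S (g r)))
        ≡⟨ sum-cong-≗ (λ r → *-comm (size r) (ind (S (g r)))) ⟩
      sum (λ r → ind (S (g r)) * size r)                               ≡⟨ sum-fibres g size (ind ∘ S) ⟨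
      sum (λ c → ind (S c) * sum (λ r → unit (g r) c * size r))
        ≡⟨ sum-cong-≗ (λ c → cong (ind (S c) *_) (trans (sum-cong-≗ (λ r → *-comm (unit (g r) c) (size r))) (g-load c))) ⟩
      sum (λ c → ind (S c) * k)                                        ≡⟨ *-distribʳ-sum k (ind ∘ S) ⟨
      sum (ind ∘ S) * k                                                ∎
      where open ≡-Reasoning

    -- Both families hold the same number of nodes, and every cluster holds exactly k > 0.
    ∣A∣≡∣B∣ : sum (ind ∘ A) ≡ sum (ind ∘ B)
    ∣A∣≡∣B∣ = *-cancelʳ-≡ (sum (ind ∘ A)) (sum (ind ∘ B)) k (begin
      sum (ind ∘ A) * k                              ≡⟨ total-mass A f f-load ⟨
      sum (λ r → size r * ind (A (f r)))             ≡⟨ sum-cong-≗ (λ r → mass r (φ r) (kind-φ r)) ⟩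
      sum (λ r → size (φ r) * ind (B (h (φ r))))
        ≡⟨ sum-permute (λ r → size r * ind (B (h r))) (proj₁ components) ⟨
      sum (λ r → size r * ind (B (h r)))             ≡⟨ total-mass B h h-load ⟩
      sum (ind ∘ B) * k                              ∎)
      where open ≡-Reasoning

    abstract
      clusters : Σ[ ψ ∈ Permutation′ ℓ ] (∀ c → B c ≡ A (ψ ⟨$⟩ʳ c))
      clusters = sum-ind-permutation B A (sym ∣A∣≡∣B∣)

    ψ : Cluster → Cluster
    ψ = proj₁ clusters ⟨$⟩ʳ_

    B≡Aψ : ∀ c → B c ≡ A (ψ c)
    B≡Aψ = proj₂ clusters

    -- Meant for labels: `φ` picks a component of the same kind, `h` its cluster in `B`, and `ψ`
    -- renames the clusters of `B` as clusters of `A`.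
    G : Mapping
    G r = if A (f r) then ψ (h (φ r)) else f r

    g : Mapping
    g = G ∘ R

    kindWithin-true : ∀ S m {r j} → kindWithin S m r ≡ suc j → S (m r) ≡ true × kind r ≡ suc j
    kindWithin-true S m {r} eq with S (m r)
    ... | true = refl , eq

    true-kindWithin : ∀ S m {r} → S (m r) ≡ true → kindWithin S m r ≡ kind r
    true-kindWithin S m {r} Smr with S (m r)
    ... | true = refl

    G-true : ∀ {r} → A (f r) ≡ true → G r ≡ ψ (h (φ r))
    G-true {r} Afr = cong (if_then ψ (h (φ r)) else f r) Afr

    u-within : B (h (φ (R u))) ≡ true × kind (φ (R u)) ≡ suc k
    u-within = kindWithin-true B h (trans (sym (kind-φ (R u)))
      (trans (true-kindWithin A f (trans (cong A (f-invariant (idempotent u))) Afu)) kind-u))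

    φRu≡Ru : φ (R u) ≡ R u
    φRu≡Ru = kind-u⁻¹ (proj₂ u-within)

    hRu≡hRv : h (R u) ≡ h (R v)
    hRu≡hRv = trans (h-invariant (idempotent u))
      (trans (proj₂ h-feasible (merge-joins ℓ k R u v)) (sym (h-invariant (idempotent v))))

    v-within : kindWithin B h (R v) ≡ suc (suc k)
    v-within = trans (true-kindWithin B h (trans (cong B (sym (trans (cong h φRu≡Ru) hRu≡hRv))) (proj₁ u-within))) kind-v

    φ⁻¹Rv : Node
    φ⁻¹Rv = proj₁ components ⟨$⟩ˡ R v

    φφ⁻¹Rv : φ φ⁻¹Rv ≡ R v
    φφ⁻¹Rv = inverseʳ (proj₁ components)

    -- Only the cluster of `u` was put into `A`; that of `v` follows. Since `h` keeps both
    -- components together, that of `v` lies in `B`, and its kind is unique, so it can only be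
    -- matched with itself.
    v-preimage : A (f φ⁻¹Rv) ≡ true × kind φ⁻¹Rv ≡ suc (suc k)
    v-preimage = kindWithin-true A f (trans (kind-φ φ⁻¹Rv) (trans (cong (kindWithin B h) φφ⁻¹Rv) v-within))

    φ⁻¹Rv≡Rv : φ⁻¹Rv ≡ R v
    φ⁻¹Rv≡Rv = kind-v⁻¹ (proj₂ v-preimage)

    gu≡gv : g u ≡ g v
    gu≡gv = begin
      G (R u)            ≡⟨ G-true (trans (cong A (f-invariant (idempotent u))) Afu) ⟩
      ψ (h (φ (R u)))    ≡⟨ cong (ψ ∘ h) φRu≡Ru ⟩
      ψ (h (R u))        ≡⟨ cong ψ hRu≡hRv ⟩
      ψ (h (R v))        ≡⟨ cong (ψ ∘ h) (trans (cong φ (sym φ⁻¹Rv≡Rv)) φφ⁻¹Rv) ⟨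
      ψ (h (φ (R v)))    ≡⟨ G-true (subst (λ r → A (f r) ≡ true) φ⁻¹Rv≡Rv (proj₁ v-preimage)) ⟨
      G (R v)            ∎
      where open ≡-Reasoning

    unit-apart : ∀ (d c : Cluster) → A d ≢ A c → unit d c ≡ 0
    unit-apart d c Ad≢Ac = unit-≢ (Ad≢Ac ∘ cong A)

    -- By `mass`, size r may be replaced by size (φ r) restricted to `B`, and nodes outside `A` give
    -- zero on both sides. The right side depends on φ r alone, so the load can be reindexed along
    -- `φ`.
    inside : ∀ c → A c ≡ true → ∀ r →
             size r * unit (G r) c ≡ size (φ r) * ind (B (h (φ r))) * unit (ψ (h (φ r))) c
    inside c Ac r with A (f r) in Afr
    ... | true  = cong (_* unit (ψ (h (φ r))) c)
                    (trans (sym (*-identityʳ (size r))) (trans (cong (λ b → size r * ind b) (sym Afr)) (mass r (φ r) (kind-φ r))))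
    ... | false = begin
      size r * unit (f r) c
        ≡⟨ cong (size r *_) (unit-apart (f r) c (λ eq → contradiction (trans (sym Afr) (trans eq Ac)) λ())) ⟩
      size r * 0                                                     ≡⟨ *-zeroʳ (size r) ⟩
      0
        ≡⟨ cong (_* unit (ψ (h (φ r))) c) (*-zeroʳ (size r)) ⟨
      size r * ind false * unit (ψ (h (φ r))) c
        ≡⟨ cong (λ b → size r * ind b * unit (ψ (h (φ r))) c) Afr ⟨
      size r * ind (A (f r)) * unit (ψ (h (φ r))) c
        ≡⟨ cong (_* unit (ψ (h (φ r))) c) (mass r (φ r) (kind-φ r)) ⟩
      size (φ r) * ind (B (h (φ r))) * unit (ψ (h (φ r))) c          ∎
      where open ≡-Reasoning

    outside : ∀ c → A c ≡ false → ∀ r → size r * unit (G r) c ≡ size r * unit (f r) c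
    outside c Ac r with A (f r) in Afr
    ... | false = refl
    ... | true  = trans moved (sym (trans
      (cong (size r *_) (unit-apart (f r) c (λ eq → contradiction (trans (sym Afr) (trans eq Ac)) λ())))
      (*-zeroʳ (size r))))
      where
      mass′ : size r ≡ size (φ r) * ind (B (h (φ r)))
      mass′ = trans (sym (*-identityʳ (size r))) (trans (cong (λ b → size r * ind b) (sym Afr)) (mass r (φ r) (kind-φ r)))
      moved : size r * unit (ψ (h (φ r))) c ≡ 0
      moved with B (h (φ r)) in Bhφr
      -- Here ψ (h (φ r)) may lie outside `A`, but then `r` labels no component and has size zero.
      ... | false = cong (_* unit (ψ (h (φ r))) c) (trans mass′ (trans (cong (λ b → size (φ r) * ind b) Bhφr) (*-zeroʳ (size (φ r)))))
      ... | true  = trans (cong (size r *_) (unit-apart (ψ (h (φ r))) c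
                      (λ eq → contradiction (trans (sym Bhφr) (trans (B≡Aψ (h (φ r))) (trans eq Ac))) λ()))) (*-zeroʳ (size r))

    g-count : ∀ c → ∣ nodesIn g c ∣ ≡ sum (λ r → size r * unit (G r) c)
    g-count c = trans (∣tabulate∣ (λ x → does (g x ≟ c))) (sym (sum-size (λ r → unit (G r) c)))

    g-valid : Valid g
    g-valid c with A c in Ac
    ... | false = trans (g-count c) (trans (sum-cong-≗ (outside c Ac)) (f-load c))
    ... | true  = begin
      ∣ nodesIn g c ∣                                                                  ≡⟨ g-count c ⟩
      sum (λ r → size r * unit (G r) c)                                                ≡⟨ sum-cong-≗ (inside c Ac) ⟩
      sum (λ r → size (φ r) * ind (B (h (φ r))) * unit (ψ (h (φ r))) c)
        ≡⟨ sum-permute (λ r → size r * ind (B (h r)) * unit (ψ (h r)) c) (proj₁ components) ⟨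
      sum (λ r → size r * ind (B (h r)) * unit (ψ (h r)) c)                            ≡⟨ sum-cong-≗ pullback ⟩
      sum (λ r → size r * unit (h r) ψ⁻¹c)                                             ≡⟨ h-load ψ⁻¹c ⟩
      k                                                                                ∎
      where
      open ≡-Reasoning
      ψ⁻¹c : Cluster
      ψ⁻¹c = proj₁ clusters ⟨$⟩ˡ c
      pullback : ∀ r → size r * ind (B (h r)) * unit (ψ (h r)) c ≡ size r * unit (h r) ψ⁻¹c
      pullback r with h r ≟ ψ⁻¹c
      ... | yes hr≡ = begin
        size r * ind (B (h r)) * unit (ψ (h r)) c
          ≡⟨ cong₂ (λ b d → size r * ind b * unit d c) (trans (B≡Aψ (h r)) (trans (cong A ψhr≡c) Ac)) ψhr≡c ⟩
        size r * 1 * unit c c                       ≡⟨ cong₂ _*_ (*-identityʳ (size r)) (unit-refl c) ⟩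
        size r * 1                                  ∎
        where
        ψhr≡c : ψ (h r) ≡ c
        ψhr≡c = trans (cong ψ hr≡) (inverseʳ (proj₁ clusters))
      ... | no hr≢ = begin
        size r * ind (B (h r)) * unit (ψ (h r)) c   ≡⟨ cong (size r * ind (B (h r)) *_) (unit-≢ ψhr≢c) ⟩
        size r * ind (B (h r)) * 0                  ≡⟨ *-zeroʳ (size r * ind (B (h r))) ⟩
        0                                           ≡⟨ *-zeroʳ (size r) ⟨
        size r * 0                                  ∎
        where
        ψhr≢c : ψ (h r) ≢ c
        ψhr≢c ψhr≡c = hr≢ (trans (sym (inverseˡ (proj₁ clusters))) (cong (proj₁ clusters ⟨$⟩ˡ_) ψhr≡c))

    -- The factor `size` in `outside` cancels at the label of `x`, whose component is nonempty.
    unchanged : ∀ {c} → A c ≡ false → nodesIn f c ≡ nodesIn g c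
    unchanged {c} Ac = tabulate-cong λ x → ind-injective (begin
      unit (f x) c         ≡⟨ cong (λ d → unit d c) (f-invariant (idempotent x)) ⟨
      unit (f (R x)) c     ≡⟨ *-cancelˡ-≡ _ _ (size (R x)) {{>-nonZero (size-R>0 x)}} (outside c Ac (R x)) ⟨
      unit (g x) c         ∎)
      where open ≡-Reasoning

    affected≤ : affected f g ≤ sum (ind ∘ A)
    affected≤ = ≤-trans
      (≤-reflexive (∣tabulate∣ (λ c → does (¬? (≡-dec Bool._≟_ (nodesIn f c) (nodesIn g c))))))
      (sum-mono-≤ changed≤)
      where
      changed≤ : ∀ c → ind (does (¬? (≡-dec Bool._≟_ (nodesIn f c) (nodesIn g c)))) ≤ ind (A c)
      changed≤ c with A c in Ac | ≡-dec Bool._≟_ (nodesIn f c) (nodesIn g c)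
      ... | true  | yes _   = z≤n
      ... | true  | no _    = ≤-refl
      ... | false | yes _   = z≤n
      ... | false | no f≢g  = contradiction (unchanged Ac) f≢g

    g-feasible : Feasible (merge R u v) g
    g-feasible = g-valid , merge-invariant ℓ k R u v g (cong G) gu≡gv

  cheap : ∃ λ g → Feasible (merge R u v) g × affected f g ≤ 2 ^ (41 * n)
  cheap =
    let A , B , Afu , A-small , same = balanced-subfamilies n (profile f) (profile h)
          (profile-light f f-load) (profile-light h h-load)
          (λ {i} _ → trans (sum-profile f i) (sym (sum-profile h i))) (f u)
    in Rearranged.g A B Afu same , Rearranged.g-feasible A B Afu same
       , ≤-trans (Rearranged.affected≤ A B Afu same) A-small

-- Runs of COMP

module _ (ℓ k : ℕ) where
  open Repartitioning ℓ k

  record Reachable (s : State) : Set where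
    constructor reachable
    open State s
    field
      idempotent : Idempotent ℓ k components
      feasible   : Feasible components mapping

  reachable-initial : ∀ f → Valid f → Reachable (initial f)
  reachable-initial f valid = reachable (λ _ → refl) (valid , λ { refl → refl })

  reachable-step : ∀ {s r t} → Step s r t → Reachable s → Reachable t
  reachable-step (skip _) good = good
  reachable-step (join {R} {f} {u} {v} u≁v fu≡fv) (reachable idem (valid , inv)) =
    reachable (merge-idempotent ℓ k R u v u≁v idem) (valid , merge-invariant ℓ k R u v f inv fu≡fv)
  reachable-step (remap {R} {f} {u} {v} u≁v _ (g-feasible , _)) (reachable idem _) =
    reachable (merge-idempotent ℓ k R u v u≁v idem) g-feasible
  reachable-step (reset {f = f} _ _ _) (reachable _ (valid , _)) = reachable-initial f valid

  -- The mapping chosen by COMP itself serves as the feasible `h` from which a cheap mapping is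
  -- built; being cheapest, the chosen one affects no more clusters than that.
  remap-affects≤ : .{{_ : NonZero k}} → ∀ {s σ t f g} {run : Run s σ t} →
                   Reachable s → RemapsIn f g run → affected f g ≤ 2 ^ (41 * suc (suc k))
  remap-affects≤ {f = f} {h} (reachable idem feasible) (here {R} {u} {v} {u≁v = u≁v} {best = best}) =
    let g , g-feasible , few = Remapping.cheap ℓ k R f h u v idem u≁v feasible (proj₁ best)
    in ≤-trans (proj₂ best g g-feasible) few
  remap-affects≤ good (there {step = step} remaps) = remap-affects≤ (reachable-step step good) remaps

corollary1 : ∃[ C ] C > 0 ×
    (∀ (ℓ k : ℕ) .{{_ : NonZero ℓ}} .{{_ : NonZero k}} →
    let open Repartitioning ℓ k in
    (f₀ : Mapping) → Valid f₀ →
    (σ : List Request) →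
    ∀ {s} (run : Run (initial f₀) σ s) →
    ∀ {f g} → RemapsIn f g run →
    affected f g ≤ 2 ^ (C * k))
-- As k ≥ 1, k + 2 ≤ 3k, and 123 = 41 · 3.
corollary1 = 123 , z<s , λ ℓ k f₀ valid σ run remaps →
  ≤-trans (remap-affects≤ ℓ k (reachable-initial ℓ k f₀ valid) remaps) (^-monoʳ-≤ 2 (exponent k))
  where
  exponent : ∀ k .{{_ : NonZero k}} → 41 * suc (suc k) ≤ 123 * k
  exponent k = begin
    41 * (2 + k)   ≤⟨ *-monoʳ-≤ 41 (+-monoˡ-≤ k (m≤m*n 2 k)) ⟩
    41 * (2 * k + k)   ≡⟨ regroup k ⟩
    123 * k        ∎
    where
    open ≤-Reasoning
    regroup : ∀ a → 41 * (2 * a + a) ≡ 123 * a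
    regroup = solve-∀
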